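{- Let $K$ be a non-archimedean local field with valuation ring $R$, and let $S\subseteq R$ be a non-empty subset with adelic tree $T_S$. Then $n!_S=n!_{T_S}$ for every integer $n\ge 0$ (with $n<|S|$ if $S$ is finite), where $n!_S$ is Bhargava's (logarithmic) $S$-factorial of $n$ and $n!_{T_S}$ is the factorial of the rooted tree $T_S$ with the standard length function.
   Context: $K$ has normalized discrete valuation $\mathrm{val}$ (with $\mathrm{val}(0)=\infty$), valuation ring $R$, maximal ideal $\mathfrak m$, and finite residue field. Bhargava's logarithmic factorials of $S$: choose $s_0\in S$ arbitrarily; given $s_0,\dots,s_{n-1}$, choose $s_n\in S$ minimizing $\mathrm{val}\bigl(\prod_{j=0}^{n-1}(s-s_j)\bigr)$ over $s\in S$; then $n!_S:=\mathrm{val}\bigl(\prod_{j=0}^{n-1}(s_n-s_j)\bigr)$, a number independent of the choices. Adelic tree $T_S$: for each integer $h\ge0$ let $\phi_h:R\to R/\mathfrak m^h$ be the projection and $V_h=\phi_h(S)$. The vertex set of $T_S$ is $\bigsqcup_{h\ge0}V_h$, the root is the unique element of $V_0$, and $u\in V_h$ is adjacent to $v\in V_{h+1}$ if and only if $u$ is the image of $v$ under the natural map $R/\mathfrak m^{h+1}\to R/\mathfrak m^h$. Tree factorials (standard length): for a rooted tree $T$ with root $\mathfrak r$ and edges oriented away from $\mathfrak r$, the extended boundary $\widetilde\partial T$ is the set of all infinite oriented paths from $\mathfrak r$ and all oriented paths from $\mathfrak r$ to a leaf (a leaf is a vertex $\neq\mathfrak r$ of valence one, or $\mathfrak r$ if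 $T=\{\mathfrak r\}$). For distinct $\rho,\tau\in\widetilde\partial T$, $\langle\rho,\tau\rangle$ is the number of common edges. Choose $\rho_0\in\widetilde\partial T$ arbitrarily; given $\rho_0,\dots,\rho_{n-1}$, choose $\rho_n\in\widetilde\partial T\setminus\{\rho_0,\dots,\rho_{n-1}\}$ minimizing $\sum_{j<n}\langle\rho,\rho_j\rangle$. Then $n!_T:=\sum_{j<n}\langle\rho_n,\rho_j\rangle$, which is independent of the choices (and $0!_T=0$). -}

module Defs where

open import Algebra.Apartness.Bundles using (HeytingCommutativeRing; HeytingField)
open import Algebra.Bundles using (CommutativeRing)
import Algebra.Properties.CommutativeSemigroup as CommutativeSemigroupProperties
import Algebra.Properties.Monoid.Sum as MonoidSum
import Algebra.Properties.Ring as RingProperties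
open import Data.Fin.Base using (Fin; Fin′; fromℕ; inject; inject₁; toℕ; zero; suc)
open import Data.Integer.Base as ℤ using (ℤ; +_; -[1+_]; 0ℤ; 1ℤ)
import Data.Integer.Properties as ℤ
open import Data.Nat.Base as ℕ using (ℕ; zero; suc)
import Data.Nat.Properties as ℕ
open import Data.Product.Base using (Σ; ∃; ∃-syntax; _×_; _,_; proj₁; proj₂)
open import Data.Sum.Base using (_⊎_; inj₁; inj₂; swap)
open import Data.Vec.Functional using (Vector)
open import Function.Base using (_∘_)
open import Function.Bundles using (Inverse; _⇔_; Equivalence)
open import Level using (Level; _⊔_) renaming (suc to lsuc)
open import Relation.Binary.Bundles using (Setoid)
import Relation.Binary.Construct.Add.Supremum.NonStrict as AddSupremumNonStrict
import Relation.Binary.Construct.Add.Supremum.Strict as AddSupremumStrict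
import Relation.Binary.Construct.On as On
open import Relation.Binary.Core using (Rel)
open import Relation.Binary.Definitions using (Symmetric; Irreflexive; _Respects₂_)
open import Relation.Binary.PropositionalEquality as ≡ using (_≡_)
open import Relation.Nullary.Construct.Add.Supremum using (_⁺; [_]; ⊤⁺)
open import Relation.Nullary.Negation.Core using (¬_; contradiction)
open import Relation.Unary using (Pred; _∈_; _⊆_)

HasCardinality : ∀ {a ℓ} → Setoid a ℓ → ℕ → Set (a ⊔ ℓ)
HasCardinality A n = Inverse A (≡.setoid (Fin n))

module _ {v e : Level} (V : Setoid v e) where
  open Setoid V renaming (Carrier to Vertex)

  data Walk {a} (_—_ : Rel Vertex a) : ℕ → Rel Vertex (v ⊔ e ⊔ a) where
    stop : ∀ {x y} → x ≈ y → Walk _—_ 0 x y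
    step : ∀ {n x y z} → x — y → Walk _—_ n y z → Walk _—_ (suc n) x z

record RootedTree (v e a : Level) : Set (lsuc (v ⊔ e ⊔ a)) where
  infix 4 _—_
  field
    vertices : Setoid v e

  open Setoid vertices public renaming (Carrier to Vertex)

  field
    _—_        : Rel Vertex a
    —-resp     : _—_ Respects₂ _≈_
    —-sym      : Symmetric _—_
    —-irrefl   : Irreflexive _≈_ _—_
    root       : Vertex
    -- By symmetry of adjacency it suffices to reach every vertex from the root.
    connected  : ∀ x → ∃[ n ] Walk vertices _—_ n root x
    -- A cycle through the edge xy is a path from x to y avoiding that edge.
    acyclic    : ∀ {x y} → x — y → ∀ n →
                 ¬ Walk vertices
                     (λ u w → u — w × ¬ (u ≈ x × w ≈ y) × ¬ (u ≈ y × w ≈ x))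
                     n x y

module TreeFactorial {v e a : Level} (T : RootedTree v e a) where
  open RootedTree T

  HasDepth : Vertex → ℕ → Set (v ⊔ e ⊔ a)
  HasDepth x n = Walk vertices _—_ n root x ×
                 (∀ m → Walk vertices _—_ m root x → n ℕ.≤ m)

  infix 4 _⟶_
  -- The orientation of the edges away from the root.
  _⟶_ : Rel Vertex (v ⊔ e ⊔ a)
  x ⟶ y = x — y × ∃[ n ] (HasDepth x n × HasDepth y (suc n))

  HasValencyOne : Vertex → Set (v ⊔ e ⊔ a)
  HasValencyOne x = ∃[ y ] (x — y × (∀ z → x — z → z ≈ y))

  IsLeaf : Vertex → Set (v ⊔ e ⊔ a)
  IsLeaf x = (¬ x ≈ root × HasValencyOne x) ⊎ (x ≈ root × (∀ y → y ≈ root))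

  record InfinitePath : Set (v ⊔ e ⊔ a) where
    field
      vertex : ℕ → Vertex
      start  : vertex 0 ≈ root
      edge   : ∀ i → vertex i ⟶ vertex (suc i)

  record LeafPath : Set (v ⊔ e ⊔ a) where
    field
      len    : ℕ
      vertex : Fin (suc len) → Vertex
      start  : vertex zero ≈ root
      edge   : ∀ (i : Fin len) → vertex (inject₁ i) ⟶ vertex (suc i)
      end    : IsLeaf (vertex (fromℕ len))

  ∂̃ : Set (v ⊔ e ⊔ a)
  ∂̃ = InfinitePath ⊎ LeafPath

  infix 4 _at_is_
  _at_is_ : ∂̃ → ℕ → Vertex → Set e
  inj₁ ρ at i is x = InfinitePath.vertex ρ i ≈ x
  inj₂ ρ at i is x = ∃[ j ] (toℕ j ≡ i × LeafPath.vertex ρ j ≈ x)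

  infix 4 _≋_
  _≋_ : Rel ∂̃ (v ⊔ e)
  ρ ≋ τ = ∀ i x → ρ at i is x ⇔ τ at i is x

  EdgeOf : ∂̃ → Vertex × Vertex → Set e
  EdgeOf ρ (x , y) = ∃[ i ] (ρ at i is x × ρ at suc i is y)

  -- Paths traverse edges away from the root, so counting common edges as
  -- ordered pairs agrees with counting them as unordered pairs.
  CommonEdges : ∂̃ → ∂̃ → Setoid (v ⊔ e) e
  CommonEdges ρ τ = record
    { Carrier       = Σ (Vertex × Vertex) λ xy → EdgeOf ρ xy × EdgeOf τ xy
    ; _≈_           = λ { ((x , y) , _) ((x′ , y′) , _) → x ≈ x′ × y ≈ y′ }
    ; isEquivalence = record
      { refl  = Setoid.refl vertices , Setoid.refl vertices
      ; sym   = λ (p , q) → Setoid.sym vertices p , Setoid.sym vertices q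
      ; trans = λ (p , q) (p′ , q′) →
                  Setoid.trans vertices p p′ , Setoid.trans vertices q q′
      }
    }

  ⟨_,_⟩≔_ : ∂̃ → ∂̃ → ℕ → Set (v ⊔ e)
  ⟨ ρ , τ ⟩≔ k = HasCardinality (CommonEdges ρ τ) k

  open MonoidSum ℕ.+-0-monoid using (sum)

  PairingSum : ∀ {n} → ∂̃ → Vector ∂̃ n → ℕ → Set (v ⊔ e)
  PairingSum {n} ρ τ m =
    Σ (Vector ℕ n) λ k → (∀ j → ⟨ ρ , τ j ⟩≔ k j) × m ≡ sum k

  -- Fin′ i is the type of indices j < i, and inject includes it in Fin (suc n).
  record Ordering (n : ℕ) : Set (v ⊔ e ⊔ a) where
    field
      path : Vector ∂̃ (suc n)

    before : (i : Fin (suc n)) → Vector ∂̃ (toℕ i)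
    before i = λ (j : Fin′ i) → path (inject j)

    field
      distinct : ∀ i (j : Fin′ i) → ¬ path i ≋ before i j
      total    : Vector ℕ (suc n)
      isTotal  : ∀ i → PairingSum (path i) (before i) (total i)
      minimal  : ∀ i τ → (∀ j → ¬ τ ≋ before i j) →
                 ∀ m → PairingSum τ (before i) m → total i ℕ.≤ m

    value : ℕ
    value = total (fromℕ n)

  -- The factorial is the common value of all greedy orderings, which must exist.
  IsFactorial : ℕ → ℕ → Set (v ⊔ e ⊔ a)
  IsFactorial n m = (∃[ o ] Ordering.value {n} o ≡ m) ×
                    (∀ (o : Ordering n) → Ordering.value o ≡ m)

ℤ∞ : Set
ℤ∞ = ℤ ⁺

pattern ∞ = ⊤⁺

open AddSupremumNonStrict ℤ._≤_ public using () renaming (_≤⁺_ to _≤∞_)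
open AddSupremumNonStrict ℤ._≤_ using (_≤⊤⁺) renaming ([_] to [≤_])
open AddSupremumStrict ℤ._<_ public using () renaming (_<⁺_ to _<∞_)
open AddSupremumStrict ℤ._<_ using ([_]<⊤⁺) renaming ([_] to [<_])

infixl 6 _+∞_
_+∞_ : ℤ∞ → ℤ∞ → ℤ∞
[ i ] +∞ [ j ] = [ i ℤ.+ j ]
[ i ] +∞ ∞     = ∞
∞     +∞ y     = ∞

infixl 7 _⊓∞_
_⊓∞_ : ℤ∞ → ℤ∞ → ℤ∞
[ i ] ⊓∞ [ j ] = [ i ℤ.⊓ j ]
[ i ] ⊓∞ ∞     = [ i ]
∞     ⊓∞ y     = y

record DiscretelyValuedField (c ℓ₁ ℓ₂ : Level) : Set (lsuc (c ⊔ ℓ₁ ⊔ ℓ₂)) where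
  field
    heytingField : HeytingField c ℓ₁ ℓ₂

  open HeytingField heytingField public

  field
    val        : Carrier → ℤ∞
    val-cong   : ∀ {x y} → x ≈ y → val x ≡ val y
    val-∞      : ∀ {x} → val x ≡ ∞ ⇔ x ≈ 0#
    val-*      : ∀ x y → val (x * y) ≡ val x +∞ val y
    val-+      : ∀ x y → val x ⊓∞ val y ≤∞ val (x + y)
    normalized : ∀ i → ∃[ x ] val x ≡ [ i ]

  commutativeRing : CommutativeRing c ℓ₁
  commutativeRing = HeytingCommutativeRing.commutativeRing heytingCommutativeRing

  open CommutativeRing commutativeRing public
    using (ring; +-commutativeSemigroup; *-monoid) renaming (setoid to K-setoid)

  R : Pred Carrier _
  R x = [ 0ℤ ] ≤∞ val x

  𝔪 : Pred Carrier _
  𝔪 x = [ 0ℤ ] <∞ val x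

  -- The powers of the ideal 𝔪: 𝔪⁰ = R, and 𝔪ʰ⁺¹ = 𝔪 𝔪ʰ consists of the finite
  -- sums of products y z with y ∈ 𝔪 and z ∈ 𝔪ʰ.
  infix 4 _∈𝔪^_
  data _∈𝔪^_ : Carrier → ℕ → Set (c ⊔ ℓ₁) where
    base : ∀ {x} → x ∈ R → x ∈𝔪^ 0
    nil  : ∀ {h x} → x ≈ 0# → x ∈𝔪^ suc h
    cons : ∀ {h x y z w} → y ∈ 𝔪 → z ∈𝔪^ h → w ∈𝔪^ suc h →
           x ≈ y * z + w → x ∈𝔪^ suc h

  private
    module K = RingProperties ring

    0≤∞+∞ : ∀ {x y} → [ 0ℤ ] ≤∞ x → [ 0ℤ ] ≤∞ y → [ 0ℤ ] ≤∞ x +∞ y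
    0≤∞+∞ [≤ p ]    [≤ q ]    = [≤ ℤ.+-mono-≤ p q ]
    0≤∞+∞ [≤ p ]    (_ ≤⊤⁺) = _ ≤⊤⁺
    0≤∞+∞ (_ ≤⊤⁺) q         = _ ≤⊤⁺

    0≤∞⊓∞ : ∀ {x y} → [ 0ℤ ] ≤∞ x → [ 0ℤ ] ≤∞ y → [ 0ℤ ] ≤∞ x ⊓∞ y
    0≤∞⊓∞ [≤ p ]    [≤ q ]    = [≤ ℤ.⊓-glb p q ]
    0≤∞⊓∞ [≤ p ]    (_ ≤⊤⁺) = [≤ p ]
    0≤∞⊓∞ (_ ≤⊤⁺) q         = q

    ≤∞-trans : ∀ {x y z} → x ≤∞ y → y ≤∞ z → x ≤∞ z
    ≤∞-trans = AddSupremumNonStrict.≤⁺-trans ℤ._≤_ ℤ.≤-trans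

    double≥0 : ∀ x → [ 0ℤ ] ≤∞ x +∞ x → [ 0ℤ ] ≤∞ x
    double≥0 [ + n ]      _      = [≤ ℤ.+≤+ ℕ.z≤n ]
    double≥0 [ -[1+ n ] ] [≤ () ]
    double≥0 ∞            _      = _ ≤⊤⁺

    negsuc-injective : ∀ {m n} → [ -[1+ m ] ] ≡ [ -[1+ n ] ] → m ≡ n
    negsuc-injective ≡.refl = ≡.refl

    idem⇒≥0 : ∀ x → x ≡ x +∞ x → [ 0ℤ ] ≤∞ x
    idem⇒≥0 [ + n ]      _ = [≤ ℤ.+≤+ ℕ.z≤n ]
    idem⇒≥0 [ -[1+ n ] ] p =
      contradiction (ℕ.s≤s (ℕ.m≤m+n n n)) (ℕ.<-irrefl (negsuc-injective p))
    idem⇒≥0 ∞            _ = _ ≤⊤⁺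

  R-resp : ∀ {x y} → x ≈ y → x ∈ R → y ∈ R
  R-resp x≈y = ≡.subst ([ 0ℤ ] ≤∞_) (val-cong x≈y)

  R-* : ∀ {x y} → x ∈ R → y ∈ R → x * y ∈ R
  R-* p q = ≡.subst ([ 0ℤ ] ≤∞_) (≡.sym (val-* _ _)) (0≤∞+∞ p q)

  R-+ : ∀ {x y} → x ∈ R → y ∈ R → x + y ∈ R
  R-+ p q = ≤∞-trans (0≤∞⊓∞ p q) (val-+ _ _)

  R-1 : 1# ∈ R
  R-1 = idem⇒≥0 _ (≡.trans (val-cong (sym (*-identityˡ 1#))) (val-* 1# 1#))

  R-−1 : - 1# ∈ R
  R-−1 = double≥0 _ (≡.subst ([ 0ℤ ] ≤∞_)
    (≡.trans (val-cong (sym (trans (K.-1*x≈-x (- 1#)) (K.-‿involutive 1#))))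
             (val-* (- 1#) (- 1#)))
    R-1)

  R-0 : 0# ∈ R
  R-0 = ≡.subst ([ 0ℤ ] ≤∞_) (≡.sym (Equivalence.from val-∞ refl)) (_ ≤⊤⁺)

  𝔪⊆R : 𝔪 ⊆ R
  𝔪⊆R {x} p with val x | p
  ... | _ | [< q ]    = [≤ ℤ.<⇒≤ q ]
  ... | _ | [ _ ]<⊤⁺ = _ ≤⊤⁺

  𝔪^-resp : ∀ {h x y} → x ≈ y → x ∈𝔪^ h → y ∈𝔪^ h
  𝔪^-resp x≈y (base p)         = base (R-resp x≈y p)
  𝔪^-resp x≈y (nil x≈0)        = nil (trans (sym x≈y) x≈0)
  𝔪^-resp x≈y (cons p q r x≈s) = cons p q r (trans (sym x≈y) x≈s)

  𝔪^-0 : ∀ h → 0# ∈𝔪^ h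
  𝔪^-0 zero    = base R-0
  𝔪^-0 (suc h) = nil refl

  𝔪^-+ : ∀ {h x y} → x ∈𝔪^ h → y ∈𝔪^ h → x + y ∈𝔪^ h
  𝔪^-+ (base p) (base q)  = base (R-+ p q)
  𝔪^-+ (nil x≈0) y∈       =
    𝔪^-resp (sym (trans (+-cong x≈0 refl) (+-identityˡ _))) y∈
  𝔪^-+ (cons p q r x≈) y∈ = cons p q (𝔪^-+ r y∈)
    (trans (+-cong x≈ refl) (+-assoc _ _ _))

  𝔪^-* : ∀ {h r x} → r ∈ R → x ∈𝔪^ h → r * x ∈𝔪^ h
  𝔪^-* r∈ (base p)        = base (R-* r∈ p)
  𝔪^-* r∈ (nil x≈0)       =
    nil (trans (*-cong refl x≈0) (zeroʳ _))
  𝔪^-* {r = r} r∈ (cons {y = y} {z} p q s x≈) = cons p (𝔪^-* r∈ q) (𝔪^-* r∈ s)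
    (trans (*-cong refl x≈)
    (trans (distribˡ _ _ _)
           (+-cong (x∙yz≈y∙xz r y z) refl)))
    where open CommutativeSemigroupProperties
                 (CommutativeRing.*-commutativeSemigroup commutativeRing)

  𝔪^-neg : ∀ {h x} → x ∈𝔪^ h → - x ∈𝔪^ h
  𝔪^-neg x∈ = 𝔪^-resp (K.-1*x≈-x _) (𝔪^-* R-−1 x∈)

  𝔪^suc⊆𝔪^ : ∀ {h x} → x ∈𝔪^ suc h → x ∈𝔪^ h
  𝔪^suc⊆𝔪^ (nil x≈0)       = 𝔪^-resp (sym x≈0) (𝔪^-0 _)
  𝔪^suc⊆𝔪^ (cons p q r x≈) =
    𝔪^-resp (sym x≈) (𝔪^-+ (𝔪^-* (𝔪⊆R p) q) (𝔪^suc⊆𝔪^ r))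

  R/𝔪^ : ℕ → Setoid c (c ⊔ ℓ₁)
  R/𝔪^ h = record
    { Carrier       = ∃[ x ] x ∈ R
    ; _≈_           = λ (x , _) (y , _) → x - y ∈𝔪^ h
    ; isEquivalence = record
      { refl  = 𝔪^-resp (sym (-‿inverseʳ _)) (𝔪^-0 h)
      ; sym   = λ {(x , _)} {(y , _)} p →
                  𝔪^-resp (K.⁻¹-anti-homo‿- x y) (𝔪^-neg p)
      ; trans = λ {(x , _)} {(y , _)} {(z , _)} p q →
                  𝔪^-resp (telescope x y z) (𝔪^-+ p q)
      }
    }
    where
    telescope : ∀ x y z → (x - y) + (y - z) ≈ x - z
    telescope x y z =
      trans (+-assoc x (- y) (y - z))
            (+-cong refl
              (trans (sym (+-assoc (- y) y (- z)))
              (trans (+-cong (-‿inverseˡ y) refl)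
                     (+-identityˡ (- z)))))

  φ : ∀ h → (∃[ x ] x ∈ R) → Setoid.Carrier (R/𝔪^ h)
  φ h x = x

  π : ∀ h → Setoid.Carrier (R/𝔪^ (suc h)) → Setoid.Carrier (R/𝔪^ h)
  π h x = x

  subsetSetoid : ∀ {p} → Pred Carrier p → Setoid (c ⊔ p) ℓ₁
  subsetSetoid S = On.setoid {B = ∃[ x ] x ∈ S} K-setoid proj₁

record NonArchimedeanLocalField (c ℓ₁ ℓ₂ : Level) : Set (lsuc (c ⊔ ℓ₁ ⊔ ℓ₂)) where
  field
    discretelyValuedField : DiscretelyValuedField c ℓ₁ ℓ₂

  open DiscretelyValuedField discretelyValuedField public

  IsCauchy : (ℕ → Carrier) → Set
  IsCauchy a = ∀ (i : ℤ) → ∃[ N ] ∀ m n → N ℕ.≤ m → N ℕ.≤ n → [ i ] ≤∞ val (a m - a n)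

  ConvergesTo : (ℕ → Carrier) → Carrier → Set
  ConvergesTo a x = ∀ (i : ℤ) → ∃[ N ] ∀ n → N ℕ.≤ n → [ i ] ≤∞ val (a n - x)

  field
    complete           : ∀ a → IsCauchy a → ∃[ x ] ConvergesTo a x
    residueFieldFinite : ∃[ q ] HasCardinality (R/𝔪^ 1) q

module _ {c ℓ₁ ℓ₂} (K : DiscretelyValuedField c ℓ₁ ℓ₂) where
  open DiscretelyValuedField K

  module BhargavaFactorial {p} (S : Pred Carrier p) where
    open MonoidSum *-monoid using () renaming (sum to ∏)

    record Ordering (n : ℕ) : Set (c ⊔ p) where
      field
        s  : Vector Carrier (suc n)
        s∈ : ∀ i → s i ∈ S

      valProduct : Fin (suc n) → Carrier → ℤ∞
      valProduct i x = val (∏ λ (j : Fin′ i) → x - s (inject j))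

      field
        minimal : ∀ i {x} → x ∈ S → valProduct i (s i) ≤∞ valProduct i x

      value : ℤ∞
      value = valProduct (fromℕ n) (s (fromℕ n))

    IsFactorial : ℕ → ℤ∞ → Set (c ⊔ p)
    IsFactorial n x = (∃[ o ] Ordering.value {n} o ≡ x) ×
                      (∀ (o : Ordering n) → Ordering.value o ≡ x)

  module _ {p} (S : Pred Carrier p) (S⊆R : S ⊆ R) (nonEmpty : ∃[ s ] s ∈ S) where

    -- V h is the image of S under φ h.
    V : ℕ → Setoid (c ⊔ ℓ₁ ⊔ p) (c ⊔ ℓ₁)
    V h = On.setoid {B = ∃[ u ] ∃[ s ] Σ (s ∈ S) λ s∈ → φ h (s , S⊆R s∈) ≈ʰ u}
                    (R/𝔪^ h) proj₁
      where open Setoid (R/𝔪^ h) using () renaming (_≈_ to _≈ʰ_)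

    Vertex : Set (c ⊔ ℓ₁ ⊔ p)
    Vertex = Σ ℕ λ h → Setoid.Carrier (V h)

    infix 4 _≈ᵛ_ _⋖_ _—ᵛ_
    data _≈ᵛ_ : Rel Vertex (c ⊔ ℓ₁ ⊔ p) where
      same : ∀ {h u w} → Setoid._≈_ (V h) u w → (h , u) ≈ᵛ (h , w)

    data _⋖_ : Rel Vertex (c ⊔ ℓ₁ ⊔ p) where
      child : ∀ {h} {u : Setoid.Carrier (V h)} {w : Setoid.Carrier (V (suc h))} →
              Setoid._≈_ (R/𝔪^ h) (proj₁ u) (π h (proj₁ w)) →
              (h , u) ⋖ (suc h , w)

    _—ᵛ_ : Rel Vertex (c ⊔ ℓ₁ ⊔ p)
    u —ᵛ w = u ⋖ w ⊎ w ⋖ u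

    vertexSetoid : Setoid (c ⊔ ℓ₁ ⊔ p) (c ⊔ ℓ₁ ⊔ p)
    vertexSetoid = record
      { Carrier       = Vertex
      ; _≈_           = _≈ᵛ_
      ; isEquivalence = record
        { refl  = λ { {h , u} → same (Setoid.refl (V h) {u}) }
        ; sym   = λ { (same {h} {u} {w} p) → same (Setoid.sym (V h) {u} {w} p) }
        ; trans = λ { (same {h} {u} {w} p) (same {w = t} q) →
                      same (Setoid.trans (V h) {u} {w} {t} p q) }
        }
      }

    private
      module V = Setoid vertexSetoid
      module Q h = Setoid (R/𝔪^ h)

      level : Vertex → ℕ
      level = proj₁

      point : Vertex → ∃[ x ] x ∈ R
      point u = proj₁ (proj₂ u)

      coarsen : ∀ {h k} → h ℕ.≤′ k → ∀ {x y} → Q._≈_ k x y → Q._≈_ h x y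
      coarsen ℕ.≤′-refl     p = p
      coarsen (ℕ.≤′-step q) {x} {y} p = coarsen q {x} {y} (𝔪^suc⊆𝔪^ p)

      ⋖-resp : ∀ {u u′ w w′} → u ≈ᵛ u′ → w ≈ᵛ w′ → u ⋖ w → u′ ⋖ w′
      ⋖-resp {_ , u , _} {_ , u′ , _} {_ , w , _} {_ , w′ , _}
             (same {h} p) (same q) (child r) =
        child (Q.trans h {u′} {u} {w′} (Q.sym h {u} {u′} p)
                (Q.trans h {u} {w} {w′} r (𝔪^suc⊆𝔪^ q)))

      —-resp : ∀ {u u′ w w′} → u ≈ᵛ u′ → w ≈ᵛ w′ → u —ᵛ w → u′ —ᵛ w′
      —-resp p q (inj₁ r) = inj₁ (⋖-resp p q r)
      —-resp p q (inj₂ r) = inj₂ (⋖-resp q p r)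

      ⋖-irrefl : ∀ {u w} → u ≈ᵛ w → ¬ u ⋖ w
      ⋖-irrefl (same _) ()

      snoc : ∀ {n x y z} → Walk vertexSetoid _—ᵛ_ n x y → y —ᵛ z →
             Walk vertexSetoid _—ᵛ_ (suc n) x z
      snoc (stop p)   e = step (—-resp (V.sym p) V.refl e) (stop V.refl)
      snoc (step d w) e = step d (snoc w e)

      -- V 0 has a single class, so the chosen element of S does not matter.
      theRoot : Vertex
      theRoot = let (s , s∈) = nonEmpty in
        0 , φ 0 (s , S⊆R s∈) , s , s∈ , Q.refl 0 {φ 0 (s , S⊆R s∈)}

      walkTo : ∀ h (u : Setoid.Carrier (V h)) →
               Walk vertexSetoid _—ᵛ_ h theRoot (h , u)
      walkTo zero    (x , _) =
        stop (same (base (R-+ (S⊆R (proj₂ nonEmpty))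
                              (R-resp (K.-1*x≈-x _) (R-* R-−1 (proj₂ x))))))
        where module K = RingProperties ring
      walkTo (suc h) (x , s , s∈ , p) =
        snoc (walkTo h (x , s , s∈ , 𝔪^suc⊆𝔪^ p)) (inj₁ (child (Q.refl h {x})))

      Below : Vertex → Vertex → Set (c ⊔ ℓ₁)
      Below v w = level v ℕ.≤ level w × Q._≈_ (level v) (point v) (point w)

      Below-refl : ∀ v → Below v v
      Below-refl v = ℕ.≤-refl , Q.refl (level v) {point v}

      Below-resp : ∀ {v u w} → u ≈ᵛ w → Below v u → Below v w
      Below-resp {k , v , _} {_ , u , _} {_ , w , _} (same p) (q , r) =
        q , Q.trans k {v} {u} {w} r (coarsen (ℕ.≤⇒≤′ q) {u} {w} p)

      Below-child : ∀ {v u w} → u ⋖ w → Below v u → Below v w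
      Below-child {k , v , _} {_ , u , _} {_ , w , _} (child p) (q , r) =
        ℕ.m≤n⇒m≤1+n q ,
        Q.trans k {v} {u} {w} r (coarsen (ℕ.≤⇒≤′ q) {u} {w} p)

      Below-parent : ∀ {p v u w} → p ⋖ v → u ⋖ w → ¬ (u ≈ᵛ p × w ≈ᵛ v) →
                     Below v w → Below v u
      Below-parent {_ , p , _} {_ , v , _} {_ , u , _} {_ , w , _}
                   (child {k} d) (child {h} e) avoid (q , r)
        with ℕ.m≤n⇒m<n∨m≡n q
      ... | inj₁ (ℕ.s≤s k<h) = k<h ,
        Q.trans (suc k) {v} {w} {u} r
          (coarsen (ℕ.≤⇒≤′ k<h) {w} {u} (Q.sym h {u} {w} e))
      ... | inj₂ ≡.refl = contradiction
        ( same (Q.trans k {u} {w} {p} e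
                 (Q.sym k {p} {w} (Q.trans k {p} {v} {w} d (𝔪^suc⊆𝔪^ r))))
        , same (Q.sym (suc k) {v} {w} r))
        avoid

      Avoiding : Vertex → Vertex → Rel Vertex (c ⊔ ℓ₁ ⊔ p)
      Avoiding x y u w = u —ᵛ w × ¬ (u ≈ᵛ x × w ≈ᵛ y) × ¬ (u ≈ᵛ y × w ≈ᵛ x)

      Below-walk : ∀ {p v n x y} → p ⋖ v → Walk vertexSetoid (Avoiding p v) n x y →
                   (Below v x → Below v y) × (Below v y → Below v x)
      Below-walk {v = v} d (stop q) =
        Below-resp {v} q , Below-resp {v} (V.sym q)
      Below-walk {v = v} d (step (inj₁ e , a , b) t) with f , g ← Below-walk d t =
        f ∘ Below-child {v} e , Below-parent d e a ∘ g
      Below-walk {v = v} d (step (inj₂ e , a , b) t) with f , g ← Below-walk d t =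
        f ∘ Below-parent d e (λ (q , r) → b (r , q)) , Below-child {v} e ∘ g

      parent-notBelow : ∀ {p v} → p ⋖ v → ¬ Below v p
      parent-notBelow (child _) (q , _) = ℕ.<-irrefl ≡.refl q

      swapAvoiding : ∀ {x y n u w} → Walk vertexSetoid (Avoiding x y) n u w →
                     Walk vertexSetoid (Avoiding y x) n u w
      swapAvoiding (stop q)             = stop q
      swapAvoiding (step (e , a , b) t) = step (e , b , a) (swapAvoiding t)

      noCycle : ∀ {x y} → x —ᵛ y → ∀ n → ¬ Walk vertexSetoid (Avoiding x y) n x y
      noCycle {y = y} (inj₁ d) n t =
        parent-notBelow d (proj₂ (Below-walk d t) (Below-refl y))
      noCycle {x = x} (inj₂ d) n t =
        parent-notBelow d (proj₁ (Below-walk d (swapAvoiding t)) (Below-refl x))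

    adelicTree : RootedTree (c ⊔ ℓ₁ ⊔ p) (c ⊔ ℓ₁ ⊔ p) (c ⊔ ℓ₁ ⊔ p)
    adelicTree = record
      { vertices  = vertexSetoid
      ; _—_       = _—ᵛ_
      ; —-resp    = —-resp V.refl , λ q → —-resp q V.refl
      ; —-sym     = swap
      ; —-irrefl  = λ { q (inj₁ r) → ⋖-irrefl q r
                      ; q (inj₂ r) → ⋖-irrefl (V.sym q) r }
      ; root      = theRoot
      ; connected = λ { (h , u) → h , walkTo h u }
      ; acyclic   = noCycle
      }

{-# OPTIONS --safe #-}

-- Let d(ρ, τ) be the number of levels on which two boundary paths of the adelic
-- tree stay together after the root, ∞ if they never part. The elements of S embed
-- densely in the boundary, with val (x − y) = d(x, y), so a sequence chosen greedily
-- in S is also greedy among all paths, and both factorials are the n-th increment of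
-- a greedy sequence of the one ultrametric space (∂̃, d). That increment does not
-- depend on the choices: by the exchange lemma below, the first k points of a greedy
-- sequence minimize the total energy Σ_{i<j} d(x_i, x_j) over all k-tuples. It is
-- finite because the first n + 1 points are distinct when |S| > n.

module Submission where

open import Defs
open import Algebra.Bundles using (AbelianGroup; CommutativeMonoid)
import Algebra.Properties.CommutativeSemigroup as CommutativeSemigroupProperties
import Algebra.Properties.Group as GroupProperties
import Algebra.Properties.Monoid.Sum as MonoidSum
import Algebra.Properties.Ring as RingProperties
open import Axiom.ExcludedMiddle using (ExcludedMiddle)
open import Data.Fin.Base using (Fin; Fin′; fromℕ; fromℕ<; inject; inject₁; toℕ; zero; suc)
open import Data.Fin.Permutation using (↔⇒≡)
import Data.Fin.Properties as Fin
open import Data.Integer.Base as ℤ using (+_; -[1+_]; +≤+; -≤+; +<+)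
import Data.Integer.Properties as ℤ
open import Data.List.Base using (List; []; _∷_; foldr; length; applyDownFrom)
open import Data.List.Properties using (length-applyDownFrom)
open import Data.List.Relation.Binary.Permutation.Propositional as ↭ using (_↭_)
open import Data.List.Relation.Binary.Permutation.Propositional.Properties
  using (All-resp-↭; ↭-length)
open import Data.List.Relation.Unary.All as All using (All; []; _∷_)
open import Data.Nat.Base as ℕ using (ℕ; zero; suc; _<_)
open import Data.Nat.Induction using (<-rec)
import Data.Nat.Properties as ℕ
open import Data.Product.Base using (∃-syntax; _×_; _,_; proj₁; proj₂)
open import Data.Sum.Base using (inj₁; inj₂)
open import Data.Vec.Functional using (Vector)
open import Function.Base using (_∘_; case_of_)
open import Function.Bundles using (Equivalence; Inverse)
import Function.Construct.Composition as Composition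
import Function.Construct.Symmetry as Symmetry
open import Level using (Level)
open import Relation.Binary.Bundles using (Setoid; TotalOrder)
import Relation.Binary.Construct.Add.Supremum.NonStrict as AddSupremumNonStrict
import Relation.Binary.Construct.Add.Supremum.Strict as AddSupremumStrict
open import Relation.Binary.Definitions using (_Respects_; tri<; tri≈; tri>)
open import Relation.Binary.PropositionalEquality as ≡
  using (_≡_; _≢_; refl; sym; trans; cong; cong₂; subst; subst₂; module ≡-Reasoning)
import Relation.Binary.Reasoning.PartialOrder as ≤-Reasoning
open import Relation.Nullary.Construct.Add.Supremum using ([_]; []-injective)
open import Relation.Nullary.Decidable.Core using (yes; no)
open import Relation.Nullary.Negation.Core using (¬_; contradiction)
open import Relation.Unary using (Pred; _∈_; _⊆_)

open AddSupremumNonStrict ℤ._≤_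
  using (_≤⊤⁺; [≤]-injective; ≤⁺-isTotalOrder-≡) renaming ([_] to [≤_])
open AddSupremumStrict ℤ._<_ using ([_]<⊤⁺) renaming ([_] to [<_])

-- Order and addition on `ℤ∞`.

≤∞-totalOrder : TotalOrder _ _ _
≤∞-totalOrder = record { isTotalOrder = ≤⁺-isTotalOrder-≡ ℤ.≤-isTotalOrder }

open TotalOrder ≤∞-totalOrder using () renaming
  ( poset to ≤∞-poset; refl to ≤∞-refl; reflexive to ≤∞-reflexive
  ; trans to ≤∞-trans; antisym to ≤∞-antisym; total to ≤∞-total )

0∞ : ℤ∞
0∞ = [ + 0 ]

+∞-assoc : ∀ x y z → (x +∞ y) +∞ z ≡ x +∞ (y +∞ z)
+∞-assoc [ i ] [ j ] [ k ] = cong [_] (ℤ.+-assoc i j k)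
+∞-assoc [ i ] [ j ] ∞     = refl
+∞-assoc [ i ] ∞     z     = refl
+∞-assoc ∞     y     z     = refl

+∞-comm : ∀ x y → x +∞ y ≡ y +∞ x
+∞-comm [ i ] [ j ] = cong [_] (ℤ.+-comm i j)
+∞-comm [ i ] ∞     = refl
+∞-comm ∞     [ j ] = refl
+∞-comm ∞     ∞     = refl

+∞-identityˡ : ∀ x → 0∞ +∞ x ≡ x
+∞-identityˡ [ i ] = cong [_] (ℤ.+-identityˡ i)
+∞-identityˡ ∞     = refl

+∞-commutativeMonoid : CommutativeMonoid _ _
+∞-commutativeMonoid = record
  { _∙_ = _+∞_
  ; ε   = 0∞
  ; isCommutativeMonoid = record
    { isMonoid = record
      { isSemigroup = record
        { isMagma = ≡.isMagma _+∞_
        ; assoc   = +∞-assoc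
        }
      ; identity = +∞-identityˡ , λ x → trans (+∞-comm x 0∞) (+∞-identityˡ x)
      }
    ; comm = +∞-comm
    }
  }

open CommutativeMonoid +∞-commutativeMonoid using (monoid; commutativeSemigroup)
open CommutativeSemigroupProperties commutativeSemigroup using (x∙yz≈y∙xz)

module ℤGroup = GroupProperties (AbelianGroup.group ℤ.+-0-abelianGroup)
module ∞Sum = MonoidSum monoid
module ℕSum = MonoidSum ℕ.+-0-monoid

+∞-mono-≤∞ : ∀ {w x y z} → w ≤∞ x → y ≤∞ z → w +∞ y ≤∞ x +∞ z
+∞-mono-≤∞ [≤ p ]    [≤ q ]    = [≤ ℤ.+-mono-≤ p q ]
+∞-mono-≤∞ [≤ p ]    (_ ≤⊤⁺) = _ ≤⊤⁺
+∞-mono-≤∞ (_ ≤⊤⁺) _         = _ ≤⊤⁺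

+∞-cancelʳ-[] : ∀ {x y} i → x +∞ [ i ] ≡ y +∞ [ i ] → x ≡ y
+∞-cancelʳ-[] {[ j ]} {[ k ]} i p = cong [_] (ℤGroup.∙-cancelʳ i j k ([]-injective p))
+∞-cancelʳ-[] {∞}     {∞}     i p = refl

⊓∞-glb : ∀ {x y z} → z ≤∞ x → z ≤∞ y → z ≤∞ x ⊓∞ y
⊓∞-glb [≤ p ]    [≤ q ]    = [≤ ℤ.⊓-glb p q ]
⊓∞-glb [≤ p ]    (_ ≤⊤⁺) = [≤ p ]
⊓∞-glb (_ ≤⊤⁺) q         = q

nonNegative-≢∞ : ∀ {x} → 0∞ ≤∞ x → x ≢ ∞ → ∃[ m ] x ≡ [ + m ]
nonNegative-≢∞ ([≤_] {l = + m} _) _ = m , refl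
nonNegative-≢∞ (_ ≤⊤⁺) x≢∞ = contradiction refl x≢∞

≤∞-≢∞ : ∀ {x y} → x ≤∞ y → y ≢ ∞ → x ≢ ∞
≤∞-≢∞ (_ ≤⊤⁺) y≢∞ refl = y≢∞ refl

+∞-≢∞ : ∀ {x y} → x ≢ ∞ → y ≢ ∞ → x +∞ y ≢ ∞
+∞-≢∞ {[ _ ]} {∞} p q _ = q refl
+∞-≢∞ {∞}     {_} p q _ = p refl

-- Path distances and powers of 𝔪 are known through the levels they reach, so inequalities are
-- tested on natural thresholds. A finite `x` ≥ 0 is its own threshold, a negative one lies below
-- `y` anyway, and for `x` = `∞` the threshold `m + 1` refutes `y` = `m`.
≤∞-levels : ∀ {x y} → 0∞ ≤∞ y → (∀ h → [ + h ] ≤∞ x → [ + h ] ≤∞ y) → x ≤∞ y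
≤∞-levels {[ + h ]}      0≤y f = f h ≤∞-refl
≤∞-levels {[ -[1+ h ] ]} 0≤y f = ≤∞-trans [≤ -≤+ ] 0≤y
≤∞-levels {∞} {[ + m ]}  0≤y f =
  contradiction (ℤ.drop‿+≤+ ([≤]-injective (f (suc m) (_ ≤⊤⁺)))) ℕ.1+n≰n
≤∞-levels {∞} {[ -[1+ m ] ]} [≤ () ] f
≤∞-levels {∞} {∞}        0≤y f = _ ≤⊤⁺

≤∞-finite : ∀ {x y} → 0∞ ≤∞ y → (∀ m → y ≡ [ + m ] → x ≤∞ y) → x ≤∞ y
≤∞-finite ([≤_] {l = + m} _) f = f m refl
≤∞-finite (_ ≤⊤⁺)            f = _ ≤⊤⁺

≡∞-levels : ∀ {x} → (∀ h → [ + h ] ≤∞ x) → x ≡ ∞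
≡∞-levels f = ≤∞-antisym (_ ≤⊤⁺) (≤∞-levels (f 0) (λ h _ → f h))

i≤∣i∣ : ∀ i → i ℤ.≤ + ℤ.∣ i ∣
i≤∣i∣ (+ n)      = ℤ.≤-refl
i≤∣i∣ (-[1+ n ]) = -≤+

≱suc⇒≤ : ∀ {k} x → ¬ [ ℤ.suc k ] ≤∞ x → x ≤∞ [ k ]
≱suc⇒≤     ∞     p = contradiction (_ ≤⊤⁺) p
≱suc⇒≤ {k} [ j ] p = [≤ ℤ.≮⇒≥ (λ k<j → p [≤ ℤ.i<j⇒suc[i]≤j k<j ]) ]

sum-ℕ : ∀ {n} {t : Vector ℤ∞ n} (k : Vector ℕ n) → (∀ j → t j ≡ [ + k j ]) →
        ∞Sum.sum t ≡ [ + ℕSum.sum k ]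
sum-ℕ {zero}  k p = refl
sum-ℕ {suc n} k p = cong₂ _+∞_ (p zero) (sum-ℕ (k ∘ suc) (p ∘ suc))

sum-≢∞ : ∀ {n} {t : Vector ℤ∞ n} → (∀ j → t j ≢ ∞) → ∞Sum.sum t ≢ ∞
sum-≢∞ {zero}  p ()
sum-≢∞ {suc n} p = +∞-≢∞ (p zero) (sum-≢∞ (p ∘ suc))

summand-∞ : ∀ {n} (t : Vector ℤ∞ n) j → t j ≡ ∞ → ∞Sum.sum t ≡ ∞
summand-∞ t zero    p = cong (_+∞ ∞Sum.sum (t ∘ suc)) p
summand-∞ t (suc j) p =
  trans (cong (t zero +∞_) (summand-∞ (t ∘ suc) j p)) (+∞-comm (t zero) ∞)

-- Beyond the last index the last entry is repeated.
extend : ∀ {a} {A : Set a} {n} → Vector A (suc n) → ℕ → A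
extend             v zero    = v zero
extend {n = zero}  v (suc k) = v zero
extend {n = suc n} v (suc k) = extend (v ∘ suc) k

extend-toℕ : ∀ {a} {A : Set a} {n} (v : Vector A (suc n)) i → extend v (toℕ i) ≡ v i
extend-toℕ             v zero    = refl
extend-toℕ {n = suc n} v (suc i) = extend-toℕ (v ∘ suc) i

-- Minima and suprema by excluded middle.

module Classical (em : ∀ {ℓ} → ExcludedMiddle ℓ) where

  ¬∃¬⇒∀ : ∀ {a b} {A : Set a} {B : A → Set b} → ¬ (∃[ x ] ¬ B x) → ∀ x → B x
  ¬∃¬⇒∀ {B = B} ¬∃ x with em {P = B x}
  ... | yes b = b
  ... | no ¬b = contradiction (x , ¬b) ¬∃

  -- Either every value is `∞` and any point will do, or the search starts at a point of finite,
  -- hence natural, value and descends by strong induction on that value.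
  argmin : ∀ {a} {A : Set a} → A → (f : A → ℤ∞) → (∀ x → 0∞ ≤∞ f x) →
           ∃[ x ] ∀ y → f x ≤∞ f y
  argmin {A = A} x₀ f f≥0 with em {P = ∃[ x ] f x ≢ ∞}
  ... | no ¬∃ = x₀ , λ y → subst (f x₀ ≤∞_) (sym (¬∃¬⇒∀ ¬∃ y)) (_ ≤⊤⁺)
  ... | yes (x₁ , fx₁≢∞) with m , p ← nonNegative-≢∞ (f≥0 x₁) fx₁≢∞ =
    <-rec (λ m → ∀ x → f x ≡ [ + m ] → ∃[ z ] ∀ y → f z ≤∞ f y) descend m x₁ p
    where
    descend : ∀ m → (∀ {k} → k < m → ∀ x → f x ≡ [ + k ] → ∃[ z ] ∀ y → f z ≤∞ f y) →
              ∀ x → f x ≡ [ + m ] → ∃[ z ] ∀ y → f z ≤∞ f y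
    descend m rec x p with em {P = ∃[ y ] ¬ f x ≤∞ f y}
    ... | no ¬∃ = x , ¬∃¬⇒∀ ¬∃
    ... | yes (y , q) with nonNegative-≢∞ (f≥0 y) (λ fy≡∞ → q (subst (f x ≤∞_) (sym fy≡∞) (_ ≤⊤⁺)))
    ...   | k , r = rec (ℕ.≰⇒> (λ m≤k → q (subst₂ _≤∞_ (sym p) (sym r) [≤ +≤+ m≤k ]))) y r

  last-level : ∀ {ℓ} (P : ℕ → Set ℓ) → P 0 → ∀ {k} → ¬ P k → ∃[ m ] P m × ¬ P (suc m)
  last-level P P0 {zero}  ¬P0 = contradiction P0 ¬P0
  last-level P P0 {suc k} ¬Psk with em {P = P k}
  ... | yes Pk = k , Pk , ¬Psk
  ... | no ¬Pk = last-level P P0 ¬Pk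

  -- `P` cuts out an initial segment of ℕ: all of it, with supremum `∞`, or one ending at the level
  -- found by `last-level`. For agreement of two paths this supremum becomes `d`.
  supremum : ∀ {ℓ} (P : ℕ → Set ℓ) → P 0 → (∀ h → P (suc h) → P h) →
             ∃[ x ] ∀ h → ([ + h ] ≤∞ x → P h) × (P h → [ + h ] ≤∞ x)
  supremum P P0 down with em {P = ∃[ h ] ¬ P h}
  ... | no ¬∃ = ∞ , λ h → (λ _ → ¬∃¬⇒∀ ¬∃ h) , λ _ → _ ≤⊤⁺
  ... | yes (k , ¬Pk) with m , Pm , ¬Psm ← last-level P P0 ¬Pk = [ + m ] , λ h →
    (λ { [≤ +≤+ h≤m ] → down* (ℕ.≤⇒≤′ h≤m) Pm }) ,
    (λ Ph → [≤ +≤+ (ℕ.≮⇒≥ (λ m<h → ¬Psm (down* (ℕ.≤⇒≤′ m<h) Ph))) ])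
    where
    down* : ∀ {h k} → h ℕ.≤′ k → P k → P h
    down* ℕ.≤′-refl     p = p
    down* (ℕ.≤′-step q) p = down* q (down _ p)

-- Energy and greedy sequences in an ultrametric space.

module Ultrametric
  {y} {Y : Set y} (d : Y → Y → ℤ∞)
  (d-nonNegative : ∀ u v → 0∞ ≤∞ d u v)
  (d-sym         : ∀ u v → d u v ≡ d v u)
  -- Large values of `d` mean close points, so this is the strong triangle inequality `d u w` ≥
  -- min(`d u v`, `d v w`), phrased by thresholds `k`.
  (d-ultra       : ∀ {k u v w} → k ≤∞ d u v → k ≤∞ d v w → k ≤∞ d u w)
  where

  pairSum : Y → List Y → ℤ∞
  pairSum u = foldr (λ v s → d u v +∞ s) 0∞

  energy : List Y → ℤ∞
  energy []      = 0∞
  energy (u ∷ L) = pairSum u L +∞ energy L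

  pairSum-nonNegative : ∀ u L → 0∞ ≤∞ pairSum u L
  pairSum-nonNegative u []      = ≤∞-refl
  pairSum-nonNegative u (v ∷ L) =
    +∞-mono-≤∞ (d-nonNegative u v) (pairSum-nonNegative u L)

  energy-nonNegative : ∀ L → 0∞ ≤∞ energy L
  energy-nonNegative []      = ≤∞-refl
  energy-nonNegative (u ∷ L) =
    +∞-mono-≤∞ (pairSum-nonNegative u L) (energy-nonNegative L)

  pairSum-↭ : ∀ u {L M} → L ↭ M → pairSum u L ≡ pairSum u M
  pairSum-↭ u ↭.refl         = refl
  pairSum-↭ u (↭.prep v p)   = cong (d u v +∞_) (pairSum-↭ u p)
  pairSum-↭ u (↭.swap v w p) =
    trans (x∙yz≈y∙xz (d u v) (d u w) _)
          (cong (λ s → d u w +∞ (d u v +∞ s)) (pairSum-↭ u p))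
  pairSum-↭ u (↭.trans p q)  = trans (pairSum-↭ u p) (pairSum-↭ u q)

  energy-↭ : ∀ {L M} → L ↭ M → energy L ≡ energy M
  energy-↭ ↭.refl       = refl
  energy-↭ (↭.prep u p) = cong₂ _+∞_ (pairSum-↭ u p) (energy-↭ p)
  energy-↭ {_ ∷ _ ∷ L} {_ ∷ _ ∷ M} (↭.swap u v p) = begin
    (d u v +∞ pairSum u L) +∞ (pairSum v L +∞ energy L)
      ≡⟨ +∞-assoc (d u v) _ _ ⟩
    d u v +∞ (pairSum u L +∞ (pairSum v L +∞ energy L))
      ≡⟨ cong₂ _+∞_ (d-sym u v) (x∙yz≈y∙xz (pairSum u L) _ _) ⟩
    d v u +∞ (pairSum v L +∞ (pairSum u L +∞ energy L))
      ≡⟨ +∞-assoc (d v u) _ _ ⟨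
    (d v u +∞ pairSum v L) +∞ (pairSum u L +∞ energy L)
      ≡⟨ cong₂ (λ s t → (d v u +∞ s) +∞ t) (pairSum-↭ v p)
               (cong₂ _+∞_ (pairSum-↭ u p) (energy-↭ p)) ⟩
    (d v u +∞ pairSum v M) +∞ (pairSum u M +∞ energy M)
      ∎
    where open ≡-Reasoning
  energy-↭ (↭.trans p q) = trans (energy-↭ p) (energy-↭ q)

  -- The chosen point is brought to the head by a permutation, so that `exchange` can recurse on the
  -- remaining list.
  nearest : ∀ u v L → ∃[ w ] ∃[ M ] (v ∷ L ↭ w ∷ M × All (λ x → d u x ≤∞ d u w) M)
  nearest u v []      = v , [] , ↭.refl , []
  nearest u v (x ∷ L) with w , M , p , far ← nearest u x L with ≤∞-total (d u v) (d u w)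
  ... | inj₁ v≤w = w , v ∷ M , ↭.trans (↭.prep v p) (↭.swap v w ↭.refl) , v≤w ∷ far
  ... | inj₂ w≤v = v , w ∷ M , ↭.prep v p , w≤v ∷ All.map (λ q → ≤∞-trans q w≤v) far

  -- Match each point of A in turn with its nearest unmatched point of B; the
  -- ultrametric inequality brings the point of B left over at least as close to
  -- the match of a as to a itself.
  exchange : ∀ A B → length B ≡ suc (length A) →
             ∃[ b ] ∃[ B′ ] (B ↭ b ∷ B′ × pairSum b A ≤∞ pairSum b B′)
  exchange []      (b ∷ [])     _ = b , [] , ↭.refl , ≤∞-refl
  exchange (a ∷ A) (v ∷ B)      e with w , M , p , far ← nearest a v B
    with b , B′ , q , le ← exchange A M
           (ℕ.suc-injective (trans (sym (↭-length p)) e))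
    with d-ab≤d-aw ∷ _ ← All-resp-↭ q far =
      b , w ∷ B′ , ↭.trans p (↭.trans (↭.prep w q) (↭.swap w b ↭.refl)) ,
      +∞-mono-≤∞ (d-ultra ≤∞-refl (≤∞-trans (≤∞-reflexive (d-sym b a)) d-ab≤d-aw)) le

  -- The descending list makes the energy of the first `k + 1` points unfold to
  -- `distances f k (f k)` plus the energy of the first `k`: the increments of a greedy sequence are
  -- differences of energies.
  distances : (ℕ → Y) → (k : ℕ) → Y → ℤ∞
  distances f k u = pairSum u (applyDownFrom f k)

  Greedy : (ℕ → Y) → ℕ → Set y
  Greedy f n = ∀ {k} → k < n → ∀ u → distances f k (f k) ≤∞ distances f k u

  -- Exchanging against the greedy prefix singles out a `b` in `B`. The greedy point costs at most
  -- what `b` costs against the prefix, hence at most what `b` costs against the rest `B′` of `B`;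
  -- the induction hypothesis handles `B′`.
  greedy-minimizes : ∀ {f} n → Greedy f n → ∀ B → length B ≡ n →
                     energy (applyDownFrom f n) ≤∞ energy B
  greedy-minimizes     zero    g [] _ = ≤∞-refl
  greedy-minimizes {f} (suc n) g B e
    with b , B′ , p , le ← exchange (applyDownFrom f n) B
           (trans e (cong suc (sym (length-applyDownFrom f n)))) =
    begin
      distances f n (f n) +∞ energy (applyDownFrom f n)
        ≤⟨ +∞-mono-≤∞ (≤∞-trans (g ℕ.≤-refl b) le)
             (greedy-minimizes n (g ∘ ℕ.m≤n⇒m≤1+n) B′
               (ℕ.suc-injective (trans (sym (↭-length p)) e))) ⟩
      pairSum b B′ +∞ energy B′
        ≡⟨ energy-↭ p ⟨
      energy B
        ∎
    where open ≤-Reasoning ≤∞-poset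

  greedy-energy-unique : ∀ {f g} n → Greedy f n → Greedy g n →
                         energy (applyDownFrom f n) ≡ energy (applyDownFrom g n)
  greedy-energy-unique {f} {g} n p q = ≤∞-antisym
    (greedy-minimizes n p (applyDownFrom g n) (length-applyDownFrom g n))
    (greedy-minimizes n q (applyDownFrom f n) (length-applyDownFrom f n))

  energy-≢∞ : ∀ {f} n → (∀ {k} → k < n → distances f k (f k) ≢ ∞) →
              energy (applyDownFrom f n) ≢ ∞
  energy-≢∞ zero    _ ()
  energy-≢∞ (suc n) p = +∞-≢∞ (p ℕ.≤-refl) (energy-≢∞ n (p ∘ ℕ.m≤n⇒m≤1+n))

  -- Both sequences have minimal, hence equal, energies at lengths `n` and `n + 1`. Finiteness of
  -- the shorter energy permits cancelling it; the last increment itself may be `∞`.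
  greedy-unique : ∀ {f g} n → Greedy f (suc n) → Greedy g (suc n) →
                  (∀ {k} → k < n → distances f k (f k) ≢ ∞) →
                  distances f n (f n) ≡ distances g n (g n)
  greedy-unique {f} {g} n p q fin
    with e , E≡e ← nonNegative-≢∞ (energy-nonNegative (applyDownFrom f n)) (energy-≢∞ n fin) =
    +∞-cancelʳ-[] (+ e) (begin
      distances f n (f n) +∞ [ + e ]
        ≡⟨ cong (distances f n (f n) +∞_) E≡e ⟨
      energy (applyDownFrom f (suc n))
        ≡⟨ greedy-energy-unique (suc n) p q ⟩
      energy (applyDownFrom g (suc n))
        ≡⟨ cong (distances g n (g n) +∞_) (trans (sym E≡E′) E≡e) ⟩
      distances g n (g n) +∞ [ + e ]
        ∎)
    where
    open ≡-Reasoning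
    E≡E′ : energy (applyDownFrom f n) ≡ energy (applyDownFrom g n)
    E≡E′ = greedy-energy-unique n (p ∘ ℕ.m≤n⇒m≤1+n) (q ∘ ℕ.m≤n⇒m≤1+n)

  distances-sum : ∀ f k u → ∞Sum.sum (λ (j : Fin k) → d u (f (toℕ j))) ≡ distances f k u
  distances-sum f zero    u = refl
  distances-sum f (suc k) u = begin
    ∞Sum.sum (λ (j : Fin (suc k)) → d u (f (toℕ j)))
      -- The list behind `distances` begins with `f k`, whereas the sum ends with it.
      ≡⟨ ∞Sum.sum-init-last (λ (j : Fin (suc k)) → d u (f (toℕ j))) ⟩
    ∞Sum.sum (λ (j : Fin k) → d u (f (toℕ (inject₁ j)))) +∞ d u (f (toℕ (fromℕ k)))
      ≡⟨ cong₂ _+∞_ (∞Sum.sum-cong-≗ {k} (λ j → cong (d u ∘ f) (Fin.toℕ-inject₁ j)))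
                    (cong (d u ∘ f) (Fin.toℕ-fromℕ k)) ⟩
    ∞Sum.sum (λ (j : Fin k) → d u (f (toℕ j))) +∞ d u (f k)
      ≡⟨ cong (_+∞ d u (f k)) (distances-sum f k u) ⟩
    distances f k u +∞ d u (f k)
      ≡⟨ +∞-comm _ (d u (f k)) ⟩
    d u (f k) +∞ distances f k u
      ∎
    where open ≡-Reasoning

  ∞-trans : ∀ {u v w} → d u v ≡ ∞ → d v w ≡ ∞ → d u w ≡ ∞
  ∞-trans p q = ≤∞-antisym (_ ≤⊤⁺)
    (d-ultra (≤∞-reflexive (sym p)) (≤∞-reflexive (sym q)))

  ∞-summand : (∀ {ℓ} → ExcludedMiddle ℓ) →
              ∀ f k u → distances f k u ≡ ∞ → ∃[ j ] d u (f (toℕ {k} j)) ≡ ∞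
  ∞-summand em f k u eq with em {P = ∃[ j ] d u (f (toℕ {k} j)) ≡ ∞}
  ... | yes found = found
  ... | no ¬found = contradiction (trans (distances-sum f k u) eq)
                                  (sum-≢∞ (λ j q → ¬found (j , q)))

  distances-≢∞ : ∀ f {k} u → distances f k u ≢ ∞ → ∀ {j} → j < k → d u (f j) ≢ ∞
  distances-≢∞ f {k} u fin {j} j<k eq = fin (trans (sym (distances-sum f k u))
    (summand-∞ (λ j → d u (f (toℕ {k} j))) (fromℕ< j<k)
               (trans (cong (d u ∘ f) (Fin.toℕ-fromℕ< j<k)) eq)))

  -- If the indices differed, the increment at the later one would contain an infinite summand.
  ∞⇒same-index : ∀ {f k} → (∀ {j} → j < k → distances f j (f j) ≢ ∞) →
                 ∀ {i j} → i < k → j < k → d (f i) (f j) ≡ ∞ → i ≡ j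
  ∞⇒same-index {f} finite {i} {j} i<k j<k eq with ℕ.<-cmp i j
  ... | tri≈ _ i≡j _ = i≡j
  ... | tri> _ _ j<i = contradiction eq (distances-≢∞ f (f i) (finite i<k) j<i)
  ... | tri< i<j _ _ = contradiction (trans (d-sym (f j) (f i)) eq)
                                     (distances-≢∞ f (f j) (finite j<k) i<j)

  before-sum : ∀ {n} (s : Vector Y (suc n)) i u →
               ∞Sum.sum (λ (j : Fin′ i) → d u (s (inject j))) ≡ distances (extend s) (toℕ i) u
  before-sum s i u = trans
    (∞Sum.sum-cong-≗ {toℕ i} (λ j → cong (d u)
      (trans (sym (extend-toℕ s (inject j))) (cong (extend s) (Fin.toℕ-inject j)))))
    (distances-sum (extend s) (toℕ i) u)

  -- Greediness up to `suc n` inspects only the indices at most `n`, where `extend s` agrees with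
  -- `s`; the repeated tail does not enter.
  extend-greedy : ∀ {n} (s : Vector Y (suc n)) →
                  (∀ i u → distances (extend s) (toℕ i) (s i) ≤∞ distances (extend s) (toℕ i) u) →
                  Greedy (extend s) (suc n)
  extend-greedy s minimal {k} k≤n u = begin
    distances (extend s) k (extend s k)
      ≡⟨ cong (λ k → distances (extend s) k (extend s k)) toℕ-i ⟨
    distances (extend s) (toℕ i) (extend s (toℕ i))
      ≡⟨ cong (distances (extend s) (toℕ i)) (extend-toℕ s i) ⟩
    distances (extend s) (toℕ i) (s i)
      ≤⟨ minimal i u ⟩
    distances (extend s) (toℕ i) u
      ≡⟨ cong (λ k → distances (extend s) k u) toℕ-i ⟩
    distances (extend s) k u
      ∎
    where
    open ≤-Reasoning ≤∞-poset
    i = fromℕ< k≤n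
    toℕ-i : toℕ i ≡ k
    toℕ-i = Fin.toℕ-fromℕ< k≤n

  extend-last : ∀ {n} (s : Vector Y (suc n)) →
                distances (extend s) (toℕ (fromℕ n)) (s (fromℕ n)) ≡
                distances (extend s) n (extend s n)
  extend-last {n} s = trans
    (cong (distances (extend s) (toℕ (fromℕ n))) (sym (extend-toℕ s (fromℕ n))))
    (cong (λ k → distances (extend s) k (extend s k)) (Fin.toℕ-fromℕ n))

  toℕ-before-sum : ∀ f {n} (i : Fin (suc n)) u →
                   ∞Sum.sum (λ (j : Fin′ i) → d u (f (toℕ (inject j)))) ≡ distances f (toℕ i) u
  toℕ-before-sum f i u = trans
    (∞Sum.sum-cong-≗ {toℕ i} (λ j → cong (d u ∘ f) (Fin.toℕ-inject j)))
    (distances-sum f (toℕ i) u)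

  -- If `d u w` is a finite `k` and `d u v` ≥ `k + 1`, then `d v w` ≤ `k`, since otherwise `d u w` ≥
  -- `k + 1`. The bound is a maximum of such `k + 1`; once some `d u w` is `∞`, the sum at `u` is
  -- infinite and any `v` will do.
  near⇒pairSum-≤ : ∀ u L → ∃[ i ] ∀ v → [ i ] ≤∞ d u v → pairSum v L ≤∞ pairSum u L
  near⇒pairSum-≤ u []      = + 0 , λ _ _ → ≤∞-refl
  near⇒pairSum-≤ u (w ∷ L) with d u w in eq
  ... | ∞     = + 0 , λ _ _ → _ ≤⊤⁺
  ... | [ k ] with i , near ← near⇒pairSum-≤ u L =
    i ℤ.⊔ ℤ.suc k , λ v uv → +∞-mono-≤∞
      (≱suc⇒≤ (d v w) λ vw → suc[k]≰d-uw
        (d-ultra (≤∞-trans [≤ ℤ.i≤j⊔i i (ℤ.suc k) ] uv) vw))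
      (near v (≤∞-trans [≤ ℤ.i≤i⊔j i (ℤ.suc k) ] uv))
    where
    suc[k]≰d-uw : ¬ [ ℤ.suc k ] ≤∞ d u w
    suc[k]≰d-uw q = ℤ.i≮i (ℤ.suc[i]≤j⇒i<j ([≤]-injective (subst ([ ℤ.suc k ] ≤∞_) eq q)))

  -- Greedy sequences drawn from a dense subset.

  module Dense
    {x} {X : Set x} (ι : X → Y) (dense : ∀ u i → ∃[ v ] [ i ] ≤∞ d u (ι v))
    where

    -- Approximating `u` closely enough from `X` does not increase the sum, so a minimum over `X` is
    -- a minimum over `Y`.
    dense-lowerBound : ∀ {c} L → (∀ v → c ≤∞ pairSum (ι v) L) → ∀ u → c ≤∞ pairSum u L
    dense-lowerBound L c≤ u with i , near ← near⇒pairSum-≤ u L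
                            with v , uv ← dense u i =
      ≤∞-trans (c≤ v) (near (ι v) uv)

    module _ (em : ∀ {ℓ} → ExcludedMiddle ℓ) (v₀ : X) where
      open Classical em

      abstract
        best : ∀ L → ∃[ v ] ∀ w → pairSum (ι v) L ≤∞ pairSum (ι w) L
        best L = argmin v₀ (λ v → pairSum (ι v) L) (λ v → pairSum-nonNegative (ι v) L)

      private
        -- Each choice depends on all earlier ones, so the recursion carries their list; `history≡`
        -- then recovers it from the sequence.
        history : ℕ → List Y
        history zero    = []
        history (suc k) = ι (proj₁ (best (history k))) ∷ history k

      greedySequence : ℕ → X
      greedySequence k = proj₁ (best (history k))

      private
        history≡ : ∀ k → history k ≡ applyDownFrom (ι ∘ greedySequence) k
        history≡ zero    = refl
        history≡ (suc k) = cong (ι (greedySequence k) ∷_) (history≡ k)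

      greedySequence-greedy : ∀ {n} → Greedy (ι ∘ greedySequence) n
      greedySequence-greedy {k = k} _ = dense-lowerBound (applyDownFrom (ι ∘ greedySequence) k) λ v →
        subst (λ L → pairSum (ι (greedySequence k)) L ≤∞ pairSum (ι v) L)
              (history≡ k) (proj₂ (best (history k)) v)

-- Valuations and the powers of 𝔪.

module Valuation (em : ∀ {ℓ} → ExcludedMiddle ℓ)
                 {c ℓ₁ ℓ₂} (K : DiscretelyValuedField c ℓ₁ ℓ₂) where
  open DiscretelyValuedField K renaming
    ( refl to ≈-refl; sym to ≈-sym; trans to ≈-trans; zero to *-zero )
  open MonoidSum *-monoid using () renaming (sum to ∏)

  positive⇒≥1 : ∀ {v} → 0∞ <∞ v → [ + 1 ] ≤∞ v
  positive⇒≥1 [< +<+ p ]  = [≤ +≤+ p ]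
  positive⇒≥1 [ _ ]<⊤⁺ = _ ≤⊤⁺

  val-1 : val 1# ≡ 0∞
  val-1 = idempotent (val 1#) 1≢∞ (trans (sym (val-* 1# 1#)) (val-cong (*-identityˡ 1#)))
    where
    idempotent : ∀ v → v ≢ ∞ → v +∞ v ≡ v → v ≡ 0∞
    idempotent ∞     p _ = contradiction refl p
    idempotent [ i ] _ q = cong [_] (ℤGroup.identityˡ-unique i i ([]-injective q))

    -- If 1# ≈ 0# then K is zero, and val takes no finite value.
    1≢∞ : val 1# ≢ ∞
    1≢∞ p with x , q ← normalized (+ 0) =
      case trans (sym q) (Equivalence.from val-∞ x≈0) of λ ()
      where
      x≈0 : x ≈ 0#
      x≈0 = ≈-trans (≈-sym (*-identityˡ x))
            (≈-trans (*-cong (Equivalence.to val-∞ p) ≈-refl) (zeroˡ x))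

  uniformizer : Carrier
  uniformizer = proj₁ (normalized (+ 1))

  -- A Heyting field inverts elements apart from `0#`. Excluded middle decides apartness, and
  -- tightness turns its failure into `x ≈ 0#`, which has valuation `∞`.
  val≢∞⇒invertible : ∀ {x} → val x ≢ ∞ → ∃[ y ] x * y ≈ 1#
  val≢∞⇒invertible {x} vx≢∞ with em {P = x # 0#}
  ... | no ¬x#0 = contradiction (Equivalence.from val-∞ (proj₁ (tight _ _) ¬x#0)) vx≢∞
  ... | yes x#0 with y , _ , p ← #⇒invertible x#0 =
    y , ≈-trans (*-cong (≈-sym x-0≈x) ≈-refl) p
    where
    open RingProperties ring using (-0#≈0#)
    x-0≈x : x - 0# ≈ x
    x-0≈x = ≈-trans (+-cong ≈-refl -0#≈0#) (+-identityʳ x)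

  𝔪^⇒val : ∀ {h x} → x ∈𝔪^ h → [ + h ] ≤∞ val x
  𝔪^⇒val (base x∈R)    = x∈R
  𝔪^⇒val {suc h} (nil x≈0) =
    subst ([ + suc h ] ≤∞_) (sym (Equivalence.from val-∞ x≈0)) (_ ≤⊤⁺)
  𝔪^⇒val {suc h} (cons {y = y} {z} {w} y∈𝔪 z∈ w∈ x≈) =
    subst ([ + suc h ] ≤∞_) (sym (val-cong x≈))
      (≤∞-trans (⊓∞-glb yz≥ (𝔪^⇒val w∈)) (val-+ (y * z) w))
    where
    yz≥ : [ + suc h ] ≤∞ val (y * z)
    yz≥ = subst ([ + suc h ] ≤∞_) (sym (val-* y z))
            (+∞-mono-≤∞ (positive⇒≥1 y∈𝔪) (𝔪^⇒val z∈))

  -- Dividing by the uniformizer `t` lowers the valuation by one, so `x` is the one-term sum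
  -- `t * (t⁻¹ * x) + 0#`, whose second factor is handled by induction.
  val⇒𝔪^ : ∀ h {x} → [ + h ] ≤∞ val x → x ∈𝔪^ h
  val⇒𝔪^ zero        p = base p
  val⇒𝔪^ (suc h) {x} p
    with val-t ← proj₂ (normalized (+ 1))
    with t⁻¹ , tt⁻¹≈1 ← val≢∞⇒invertible {uniformizer} (λ q → case trans (sym val-t) q of λ ()) =
    cons (subst (0∞ <∞_) (sym val-t) [< +<+ (ℕ.s≤s ℕ.z≤n) ])
         (val⇒𝔪^ h (shift (val t⁻¹x) (≤∞-trans p (≤∞-reflexive val-x))))
         (nil ≈-refl)
         (≈-trans (≈-sym tt⁻¹x≈x) (≈-sym (+-identityʳ _)))
    where
    t⁻¹x : Carrier
    t⁻¹x = t⁻¹ * x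

    tt⁻¹x≈x : uniformizer * t⁻¹x ≈ x
    tt⁻¹x≈x = ≈-trans (≈-sym (*-assoc _ _ _))
              (≈-trans (*-cong tt⁻¹≈1 ≈-refl) (*-identityˡ x))

    val-x : val x ≡ [ + 1 ] +∞ val t⁻¹x
    val-x = trans (sym (val-cong tt⁻¹x≈x))
            (trans (val-* uniformizer t⁻¹x) (cong (_+∞ val t⁻¹x) val-t))

    shift : ∀ v → [ + suc h ] ≤∞ [ + 1 ] +∞ v → [ + h ] ≤∞ v
    shift ∞     _      = _ ≤⊤⁺
    shift [ i ] [≤ q ] = [≤ subst (+ h ℤ.≤_) (ℤ.pred-suc i) (ℤ.pred-mono q) ]

  val-∏ : ∀ {n} (t : Vector Carrier n) → val (∏ t) ≡ ∞Sum.sum (val ∘ t)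
  val-∏ {zero}  t = val-1
  val-∏ {suc n} t = trans (val-* (t zero) (∏ (t ∘ suc)))
                          (cong (val (t zero) +∞_) (val-∏ (t ∘ suc)))

-- Levels and paths in the adelic tree.

module AdelicTree
  (em : ∀ {ℓ} → ExcludedMiddle ℓ)
  {c ℓ₁ ℓ₂ p} (K : DiscretelyValuedField c ℓ₁ ℓ₂)
  (S : Pred (DiscretelyValuedField.Carrier K) p)
  (S⊆R : S ⊆ DiscretelyValuedField.R K)
  (nonEmpty : ∃[ s ] s ∈ S)
  where

  open DiscretelyValuedField K
    using (Carrier; ring; *-monoid; val; val-∞; φ; R/𝔪^; 𝔪^suc⊆𝔪^; _-_; subsetSetoid)
  open Classical em
  open Valuation em K
  open MonoidSum *-monoid using () renaming (sum to ∏)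

  T : RootedTree _ _ _
  T = adelicTree K S S⊆R nonEmpty

  open RootedTree T
    using (vertices; _≈_; _—_; —-resp; root; connected) renaming (Vertex to Node)
  open TreeFactorial T

  private module VS = Setoid vertices

  infix 4 _⋖ᵀ_
  _⋖ᵀ_ : Node → Node → Set _
  _⋖ᵀ_ = _⋖_ K S S⊆R nonEmpty

  level : Node → ℕ
  level = proj₁

  level-cong : ∀ {x y} → x ≈ y → level x ≡ level y
  level-cong (same _) = refl

  parent-unique : ∀ {x x′ y y′} → x ⋖ᵀ y → x′ ⋖ᵀ y′ → y ≈ y′ → x ≈ x′
  parent-unique {_ , x , _} {_ , x′ , _} {_ , y , _} {_ , y′ , _}
                (child {h} p) (child q) (same r) =
    same (Q.trans {x} {y} {x′} p (Q.trans {y} {y′} {x′} (𝔪^suc⊆𝔪^ r) (Q.sym {x′} {y′} q)))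
    where module Q = Setoid (R/𝔪^ h)

  walk-level : ∀ {n x y} → Walk vertices _—_ n x y → level y ℕ.≤ n ℕ.+ level x
  walk-level (stop x≈y) = ℕ.≤-reflexive (sym (level-cong x≈y))
  walk-level {suc n} {x} (step (inj₁ (child _)) w) =
    ℕ.≤-trans (walk-level w) (ℕ.≤-reflexive (ℕ.+-suc n (level x)))
  walk-level {suc n} (step (inj₂ (child _)) w) =
    ℕ.m≤n⇒m≤1+n (ℕ.≤-trans (walk-level w) (ℕ.+-monoʳ-≤ n (ℕ.n≤1+n _)))

  walk-from-root : ∀ {n x} → Walk vertices _—_ n root x → level x ℕ.≤ n
  walk-from-root {n} w = ℕ.≤-trans (walk-level w) (ℕ.≤-reflexive (ℕ.+-identityʳ n))

  -- The walk given by `connected` has length exactly `level x`, and an edge changes the level by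
  -- only one, so no walk is shorter.
  level-hasDepth : ∀ x → HasDepth x (level x)
  level-hasDepth x = proj₂ (connected x) , λ _ → walk-from-root

  depth≡level : ∀ {x n} → HasDepth x n → n ≡ level x
  depth≡level {x} (w , shortest) =
    ℕ.≤-antisym (shortest _ (proj₂ (connected x))) (walk-from-root w)

  -- Orientation is defined by depth, which equals level; an edge towards the root would lower the
  -- level while raising the depth.
  ⟶⇒⋖ : ∀ {x y} → x ⟶ y → x ⋖ᵀ y
  ⟶⇒⋖ (inj₁ x⋖y , _) = x⋖y
  ⟶⇒⋖ (inj₂ (child _) , n , dx , dy) =
    contradiction (trans (sym (depth≡level dy)) (cong suc (depth≡level dx)))
                  (λ e → ℕ.<-irrefl e (ℕ.m≤n⇒m≤1+n ℕ.≤-refl))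

  ⋖⇒⟶ : ∀ {x y} → x ⋖ᵀ y → x ⟶ y
  ⋖⇒⟶ {x} {y} x⋖y@(child _) = inj₁ x⋖y , level x , level-hasDepth x , level-hasDepth y

  level-0 : ∀ {x} → level x ≡ 0 → x ≈ root
  level-0 {zero , u} refl with stop root≈x ← proj₂ (connected (0 , u)) = VS.sym root≈x

  vertexAt : ∃[ s ] s ∈ S → ℕ → Node
  vertexAt (s , s∈S) h = h , φ h (s , S⊆R s∈S) , s , s∈S ,
    Setoid.refl (R/𝔪^ h) {φ h (s , S⊆R s∈S)}

  vertexAt-⋖ : ∀ s h → vertexAt s h ⋖ᵀ vertexAt s (suc h)
  vertexAt-⋖ (s , s∈S) h = child (Setoid.refl (R/𝔪^ h) {s , S⊆R s∈S})

  representative : Node → ∃[ s ] s ∈ S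
  representative (_ , _ , s , s∈S , _) = s , s∈S

  representative-≈ : ∀ x → x ≈ vertexAt (representative x) (level x)
  representative-≈ (h , u , s , s∈S , q) =
    same (Setoid.sym (R/𝔪^ h) {φ h (s , S⊆R s∈S)} {u} q)

  child-of : ∀ x → x — vertexAt (representative x) (suc (level x))
  child-of x = proj₂ —-resp (VS.sym (representative-≈ x))
    (inj₁ (vertexAt-⋖ (representative x) (level x)))

  -- A representative in `S` yields a child of every vertex. A vertex other than the root also has a
  -- parent, two levels away from that child, so its valency is not one; and the root is never
  -- alone.
  ¬leaf : ∀ {x} → ¬ IsLeaf x
  ¬leaf (inj₂ (_ , all≈root)) = case level-cong (all≈root (vertexAt nonEmpty 1)) of λ ()
  ¬leaf {zero , u} (inj₁ (x≉root , _)) = x≉root (level-0 refl)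
  ¬leaf {suc h , u , s , s∈S , q} (inj₁ (_ , y , _ , unique)) =
    contradiction
      (trans (level-cong (unique _ (child-of (suc h , u , s , s∈S , q))))
             (sym (level-cong (unique (h , u , s , s∈S , 𝔪^suc⊆𝔪^ q)
               (inj₂ (child (Setoid.refl (R/𝔪^ h) {u})))))))
      (λ e → ℕ.<-irrefl (sym e) (ℕ.m≤n⇒m≤1+n ℕ.≤-refl))

  -- Without leaves every boundary path is infinite, which turns `∂̃` into a space of vertex
  -- sequences.
  vertexOf : ∂̃ → ℕ → Node
  vertexOf (inj₁ ρ) = InfinitePath.vertex ρ
  vertexOf (inj₂ ρ) = contradiction (LeafPath.end ρ) ¬leaf

  vertexOf-root : ∀ ρ → vertexOf ρ 0 ≈ root
  vertexOf-root (inj₁ ρ) = InfinitePath.start ρ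
  vertexOf-root (inj₂ ρ) = contradiction (LeafPath.end ρ) ¬leaf

  vertexOf-⋖ : ∀ ρ i → vertexOf ρ i ⋖ᵀ vertexOf ρ (suc i)
  vertexOf-⋖ (inj₁ ρ) i = ⟶⇒⋖ (InfinitePath.edge ρ i)
  vertexOf-⋖ (inj₂ ρ) i = contradiction (LeafPath.end ρ) ¬leaf

  at⇒vertexOf : ∀ ρ {i x} → ρ at i is x → vertexOf ρ i ≈ x
  at⇒vertexOf (inj₁ ρ) e = e
  at⇒vertexOf (inj₂ ρ) e = contradiction (LeafPath.end ρ) ¬leaf

  vertexOf⇒at : ∀ ρ {i x} → vertexOf ρ i ≈ x → ρ at i is x
  vertexOf⇒at (inj₁ ρ) e = e
  vertexOf⇒at (inj₂ ρ) e = contradiction (LeafPath.end ρ) ¬leaf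

  level-vertexOf : ∀ ρ i → level (vertexOf ρ i) ≡ i
  level-vertexOf ρ zero    = level-cong (vertexOf-root ρ)
  level-vertexOf ρ (suc i) = trans (level-⋖ (vertexOf-⋖ ρ i)) (cong suc (level-vertexOf ρ i))
    where
    level-⋖ : ∀ {x y} → x ⋖ᵀ y → level y ≡ suc (level x)
    level-⋖ (child _) = refl

  -- The ultrametric on the boundary.

  Agree : ∂̃ → ∂̃ → ℕ → Set _
  Agree ρ τ h = vertexOf ρ h ≈ vertexOf τ h

  Agree-pred : ∀ ρ τ h → Agree ρ τ (suc h) → Agree ρ τ h
  Agree-pred ρ τ h = parent-unique (vertexOf-⋖ ρ h) (vertexOf-⋖ τ h)

  abstract
    meet : ∀ ρ τ → ∃[ x ] ∀ h → ([ + h ] ≤∞ x → Agree ρ τ h) × (Agree ρ τ h → [ + h ] ≤∞ x)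
    meet ρ τ = supremum (Agree ρ τ)
      (VS.trans (vertexOf-root ρ) (VS.sym (vertexOf-root τ))) (Agree-pred ρ τ)

  d : ∂̃ → ∂̃ → ℤ∞
  d ρ τ = proj₁ (meet ρ τ)

  d⇒Agree : ∀ ρ τ {h} → [ + h ] ≤∞ d ρ τ → Agree ρ τ h
  d⇒Agree ρ τ {h} = proj₁ (proj₂ (meet ρ τ) h)

  Agree⇒d : ∀ ρ τ {h} → Agree ρ τ h → [ + h ] ≤∞ d ρ τ
  Agree⇒d ρ τ {h} = proj₂ (proj₂ (meet ρ τ) h)

  d-nonNegative : ∀ ρ τ → 0∞ ≤∞ d ρ τ
  d-nonNegative ρ τ = Agree⇒d ρ τ (VS.trans (vertexOf-root ρ) (VS.sym (vertexOf-root τ)))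

  d-sym : ∀ ρ τ → d ρ τ ≡ d τ ρ
  d-sym ρ τ = ≤∞-antisym (d-≤ ρ τ) (d-≤ τ ρ)
    where
    d-≤ : ∀ ρ τ → d ρ τ ≤∞ d τ ρ
    d-≤ ρ τ = ≤∞-levels (d-nonNegative τ ρ) λ h p → Agree⇒d τ ρ (VS.sym (d⇒Agree ρ τ p))

  d-ultra : ∀ {k ρ σ τ} → k ≤∞ d ρ σ → k ≤∞ d σ τ → k ≤∞ d ρ τ
  d-ultra {k} {ρ} {σ} {τ} p q = ≤∞-levels (d-nonNegative ρ τ) λ h r →
    Agree⇒d ρ τ (VS.trans (d⇒Agree ρ σ (≤∞-trans r p)) (d⇒Agree σ τ (≤∞-trans r q)))

  ≋⇒d≡∞ : ∀ {ρ τ} → ρ ≋ τ → d ρ τ ≡ ∞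
  ≋⇒d≡∞ {ρ} {τ} ρ≋τ = ≡∞-levels λ h → Agree⇒d ρ τ (VS.sym
    (at⇒vertexOf τ (Equivalence.to (ρ≋τ h (vertexOf ρ h)) (vertexOf⇒at ρ VS.refl))))

  -- Common edges counted by `d`.

  module CommonEdge (ρ τ : ∂̃) where
    open Setoid (CommonEdges ρ τ) renaming (Carrier to Edge; _≈_ to _≈ᵉ_) using ()

    height : Edge → ℕ
    height ((x , _) , _) = level x

    EdgeOf-height : ∀ σ {x y} → EdgeOf σ (x , y) →
                    vertexOf σ (level x) ≈ x × vertexOf σ (suc (level x)) ≈ y
    EdgeOf-height σ {x} {y} (i , p , q) =
      subst (λ h → vertexOf σ h ≈ x × vertexOf σ (suc h) ≈ y)
        (trans (sym (level-vertexOf σ i)) (level-cong (at⇒vertexOf σ p)))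
        (at⇒vertexOf σ p , at⇒vertexOf σ q)

    edge⇒Agree : ∀ e → Agree ρ τ (suc (height e))
    edge⇒Agree (_ , p , q) =
      VS.trans (proj₂ (EdgeOf-height ρ p)) (VS.sym (proj₂ (EdgeOf-height τ q)))

    Agree⇒edge : ∀ h → Agree ρ τ (suc h) → Edge
    Agree⇒edge h p = (vertexOf ρ h , vertexOf ρ (suc h)) ,
      (h , vertexOf⇒at ρ VS.refl , vertexOf⇒at ρ VS.refl) ,
      (h , vertexOf⇒at τ (VS.sym (Agree-pred ρ τ h p)) , vertexOf⇒at τ (VS.sym p))

    height-Agree⇒edge : ∀ h p → height (Agree⇒edge h p) ≡ h
    height-Agree⇒edge h _ = level-vertexOf ρ h

    height-cong : ∀ e e′ → e ≈ᵉ e′ → height e ≡ height e′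
    height-cong _ _ (p , _) = level-cong p

    height-injective : ∀ e e′ → height e ≡ height e′ → e ≈ᵉ e′
    height-injective ((x , y) , p , _) ((x′ , y′) , p′ , _) eq
      with EdgeOf-height ρ p | EdgeOf-height ρ p′
    ... | q , r | q′ , r′ rewrite eq = VS.trans (VS.sym q) q′ , VS.trans (VS.sym r) r′

    -- Edges are numbered by the level of their end nearer the root. A common edge at height `h`
    -- exists exactly when the paths agree at level `h + 1`, that is, when `h < m`.
    d≡⇒cardinality : ∀ {m} → d ρ τ ≡ [ + m ] → ⟨ ρ , τ ⟩≔ m
    d≡⇒cardinality {m} eq = record
      { to        = to
      ; from      = from
      ; to-cong   = λ {e} {e′} p → to-unique e (trans (height-cong e e′ p) (sym (toℕ-to e′)))
      ; from-cong = λ { refl → VS.refl , VS.refl }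
      ; inverse   =
          (λ {j} {e} p → to-unique e (trans (height-cong e (from j) p) (height-from j))) ,
          (λ { {e} refl → height-injective (from (to e)) e (trans (height-from (to e)) (toℕ-to e)) })
      }
      where
      height< : ∀ e → height e < m
      height< e = ℤ.drop‿+≤+
        ([≤]-injective (subst ([ + suc (height e) ] ≤∞_) eq (Agree⇒d ρ τ (edge⇒Agree e))))

      to : Edge → Fin m
      to e = fromℕ< (height< e)

      toℕ-to : ∀ e → toℕ (to e) ≡ height e
      toℕ-to e = Fin.toℕ-fromℕ< (height< e)

      to-unique : ∀ e {j} → height e ≡ toℕ j → to e ≡ j
      to-unique e q = Fin.toℕ-injective (trans (toℕ-to e) q)

      agree : ∀ (j : Fin m) → Agree ρ τ (suc (toℕ j))
      agree j = d⇒Agree ρ τ (subst ([ + suc (toℕ j) ] ≤∞_) (sym eq) [≤ +≤+ (Fin.toℕ<n j) ])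

      from : Fin m → Edge
      from j = Agree⇒edge (toℕ j) (agree j)

      height-from : ∀ j → height (from j) ≡ toℕ j
      height-from j = height-Agree⇒edge (toℕ j) (agree j)

    -- Paths that never part share an edge at every height, and a finite count would inject ℕ into
    -- `Fin k`.
    cardinality⇒d≢∞ : ∀ {k} → ⟨ ρ , τ ⟩≔ k → d ρ τ ≢ ∞
    cardinality⇒d≢∞ count eq = Fin.ℕ→Fin-notInjective (to ∘ edge) λ {i} {j} q →
      trans (sym (height-Agree⇒edge i (agree i)))
      (trans (height-cong (edge i) (edge j) (to-injective q))
             (height-Agree⇒edge j (agree j)))
      where
      open Inverse count using (to; strictlyInverseʳ; from; from-cong)

      agree : ∀ i → Agree ρ τ (suc i)
      agree i = d⇒Agree ρ τ (subst ([ + suc i ] ≤∞_) (sym eq) (_ ≤⊤⁺))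

      edge : ℕ → Edge
      edge i = Agree⇒edge i (agree i)

      to-injective : ∀ {e e′} → to e ≡ to e′ → e ≈ᵉ e′
      to-injective {e} {e′} q = E.trans {e} {from (to e)} {e′}
        (E.sym {from (to e)} {e} (strictlyInverseʳ e))
        (E.trans {from (to e)} {from (to e′)} {e′} (from-cong q) (strictlyInverseʳ e′))
        where module E = Setoid (CommonEdges ρ τ)

    cardinality⇒d≡ : ∀ {k} → ⟨ ρ , τ ⟩≔ k → d ρ τ ≡ [ + k ]
    cardinality⇒d≡ count with m , eq ← nonNegative-≢∞ (d-nonNegative ρ τ) (cardinality⇒d≢∞ count) =
      trans eq (cong (λ k → [ + k ])
        (↔⇒≡ (Composition.inverse (Symmetry.inverse (d≡⇒cardinality eq)) count)))

  PairingSum⇒sum : ∀ {n ρ} {v : Vector ∂̃ n} {m} → PairingSum ρ v m →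
                   ∞Sum.sum (λ j → d ρ (v j)) ≡ [ + m ]
  PairingSum⇒sum {ρ = ρ} {v} (k , count , m≡) =
    trans (sum-ℕ k (λ j → CommonEdge.cardinality⇒d≡ ρ (v j) (count j)))
          (cong (λ m → [ + m ]) (sym m≡))

  -- A finite sum has no infinite summand, so every pair of paths involved has a finite count of
  -- common edges.
  sum⇒PairingSum : ∀ {n ρ} {v : Vector ∂̃ n} {m} →
                   ∞Sum.sum (λ j → d ρ (v j)) ≡ [ + m ] → PairingSum ρ v m
  sum⇒PairingSum {ρ = ρ} {v} {m} eq =
    proj₁ ∘ k ,
    (λ j → CommonEdge.d≡⇒cardinality ρ (v j) (proj₂ (k j))) ,
    ℤ.+-injective ([]-injective (trans (sym eq) (sum-ℕ (proj₁ ∘ k) (proj₂ ∘ k))))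
    where
    k : ∀ j → ∃[ i ] d ρ (v j) ≡ [ + i ]
    k j = nonNegative-≢∞ (d-nonNegative ρ (v j)) λ q →
      case trans (sym eq) (summand-∞ (λ j → d ρ (v j)) j q) of λ ()

  -- The embedding of `S` into the boundary.

  ι : ∃[ s ] s ∈ S → ∂̃
  ι s = inj₁ record
    { vertex = vertexAt s
    ; start  = level-0 refl
    ; edge   = λ h → ⋖⇒⟶ (vertexAt-⋖ s h)
    }

  -- The vertex of `ρ` at level `∣ i ∣` is the class of some element of `S`, whose own path passes
  -- through it.
  ι-dense : ∀ ρ i → ∃[ s ] [ i ] ≤∞ d ρ (ι s)
  ι-dense ρ i = representative x ,
    ≤∞-trans [≤ i≤∣i∣ i ] (Agree⇒d ρ (ι (representative x))
      (subst (λ h → x ≈ vertexAt (representative x) h) (level-vertexOf ρ ℤ.∣ i ∣)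
             (representative-≈ x)))
    where x = vertexOf ρ ℤ.∣ i ∣

  -- Either side is at least `h` exactly when `s` and `t` are congruent modulo the `h`-th power of
  -- 𝔪.
  val-difference : ∀ s t → val (proj₁ s - proj₁ t) ≡ d (ι s) (ι t)
  val-difference s t = ≤∞-antisym
    (≤∞-levels (d-nonNegative (ι s) (ι t)) λ h p → Agree⇒d (ι s) (ι t) (same (val⇒𝔪^ h p)))
    -- The first argument is level 0, which shows the valuation to be non-negative.
    (≤∞-levels (level≤ (d-nonNegative (ι s) (ι t))) λ h → level≤)
    where
    level≤ : ∀ {h} → [ + h ] ≤∞ d (ι s) (ι t) → [ + h ] ≤∞ val (proj₁ s - proj₁ t)
    level≤ p with same q ← d⇒Agree (ι s) (ι t) p = 𝔪^⇒val q

  open Ultrametric d d-nonNegative d-sym (λ {k} {ρ} {σ} {τ} → d-ultra {k} {ρ} {σ} {τ}) public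
  open Dense ι ι-dense public

  d≡∞⇒≈ : ∀ s t → d (ι s) (ι t) ≡ ∞ → Setoid._≈_ (subsetSetoid S) s t
  d≡∞⇒≈ s t eq = x∙y⁻¹≈ε⇒x≈y _ _ (Equivalence.to val-∞ (trans (val-difference s t) eq))
    where open RingProperties ring using (x∙y⁻¹≈ε⇒x≈y)

  ≈⇒d≡∞ : ∀ s t → Setoid._≈_ (subsetSetoid S) s t → d (ι s) (ι t) ≡ ∞
  ≈⇒d≡∞ s t s≈t = trans (sym (val-difference s t)) (Equivalence.from val-∞ (x≈y⇒x∙y⁻¹≈ε s≈t))
    where open RingProperties ring using (x≈y⇒x∙y⁻¹≈ε)

  points : ℕ → ∃[ s ] s ∈ S
  points = greedySequence em nonEmpty

  F : ℕ → ∂̃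
  F = ι ∘ points

  F-greedy : ∀ {n} → Greedy F n
  F-greedy = greedySequence-greedy em nonEmpty

  -- Infinite sums put every `s` at distance `∞` from, hence equal to, one of the first `k` points;
  -- finite increments keep those points distinct. They therefore enumerate `S`.
  exhausted⇒cardinality : ∀ k → (∀ {j} → j < k → distances F j (F j) ≢ ∞) →
                          (∀ s → distances F k (ι s) ≡ ∞) →
                          HasCardinality (subsetSetoid S) k
  exhausted⇒cardinality k finite exhausted = record
    { to        = index
    ; from      = points ∘ toℕ
    ; to-cong   = λ {s} {t} s≈t → index-unique s
        (∞-trans {ι s} {ι t} {F (toℕ (index t))} (≈⇒d≡∞ s t s≈t) (proj₂ (coincide t)))
    ; from-cong = λ { {i} refl → Setoid.refl (subsetSetoid S) {points (toℕ i)} }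
    ; inverse   =
        (λ {j} {s} s≈ → index-unique s (≈⇒d≡∞ s (points (toℕ j)) s≈)) ,
        (λ { {s} refl → Setoid.sym (subsetSetoid S) {s} {points (toℕ (index s))}
                          (d≡∞⇒≈ s (points (toℕ (index s))) (proj₂ (coincide s))) })
    }
    where
    coincide : ∀ s → ∃[ j ] d (ι s) (F (toℕ {k} j)) ≡ ∞
    coincide s = ∞-summand em F k (ι s) (exhausted s)

    index : ∃[ s ] s ∈ S → Fin k
    index s = proj₁ (coincide s)

    index-unique : ∀ s {j} → d (ι s) (F (toℕ j)) ≡ ∞ → index s ≡ j
    index-unique s {j} eq = Fin.toℕ-injective (∞⇒same-index finite
      (Fin.toℕ<n (index s)) (Fin.toℕ<n j) (∞-trans {F (toℕ (index s))} {ι s} {F (toℕ j)}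
        (trans (d-sym (F (toℕ (index s))) (ι s)) (proj₂ (coincide s))) eq))

  valProduct-sum : ∀ {n} (s : Vector (∃[ s ] s ∈ S) n) t →
                   val (∏ λ j → proj₁ t - proj₁ (s j)) ≡ ∞Sum.sum (λ j → d (ι t) (ι (s j)))
  valProduct-sum {n} s t = trans (val-∏ (λ j → proj₁ t - proj₁ (s j)))
                             (∞Sum.sum-cong-≗ {n} (λ j → val-difference t (s j)))

  -- Comparison of the two factorials.

  module _ {n} (enough : ∀ N → HasCardinality (subsetSetoid S) N → n < N) where

    private module B = BhargavaFactorial K S

    -- At a first infinite increment `k ≤ n`, greediness makes the sum infinite for every `s`; then
    -- `S` would have exactly `k` elements, against `enough`.
    F-finite : ∀ {k} → k ℕ.≤ n → distances F k (F k) ≢ ∞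
    F-finite {k} = <-rec (λ k → k ℕ.≤ n → distances F k (F k) ≢ ∞) next k
      where
      next : ∀ k → (∀ {j} → j < k → j ℕ.≤ n → distances F j (F j) ≢ ∞) →
             k ℕ.≤ n → distances F k (F k) ≢ ∞
      next k rec k≤n eq = contradiction
        (enough k (exhausted⇒cardinality k
          (λ j<k → rec j<k (ℕ.≤-trans (ℕ.<⇒≤ j<k) k≤n))
          (λ s → ≤∞-antisym (_ ≤⊤⁺)
            (subst (_≤∞ distances F k (ι s)) eq (F-greedy {suc k} ℕ.≤-refl (ι s))))))
        (ℕ.≤⇒≯ k≤n)

    F-total : ∀ {k} → k ℕ.≤ n → ∃[ m ] distances F k (F k) ≡ [ + m ]
    F-total {k} k≤n = nonNegative-≢∞
      (pairSum-nonNegative (F k) (applyDownFrom F k)) (F-finite k≤n)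

    factorial : ℕ
    factorial = proj₁ (F-total ℕ.≤-refl)

    greedy⇒factorial : ∀ {g} → Greedy g (suc n) → distances g n (g n) ≡ [ + factorial ]
    greedy⇒factorial {g} g-greedy = trans
      (sym (greedy-unique n F-greedy g-greedy (F-finite ∘ ℕ.<⇒≤)))
      (proj₂ (F-total ℕ.≤-refl))

    bhargavaOrdering : B.Ordering n
    bhargavaOrdering = record
      { s       = proj₁ ∘ points ∘ toℕ
      ; s∈      = proj₂ ∘ points ∘ toℕ
      ; minimal = λ i {x} x∈S → subst₂ _≤∞_ (sym (product i _)) (sym (product i (x , x∈S)))
          (F-greedy (Fin.toℕ<n i) (ι (x , x∈S)))
      }
      where
      product : ∀ (i : Fin (suc n)) t →
                val (∏ λ (j : Fin′ i) → proj₁ t - proj₁ (points (toℕ (inject j)))) ≡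
                distances F (toℕ i) (ι t)
      product i t = trans (valProduct-sum (λ (j : Fin′ i) → points (toℕ (inject j))) t)
                          (toℕ-before-sum F i (ι t))

    bhargava-value : ∀ o → B.Ordering.value {n} o ≡ [ + factorial ]
    bhargava-value o = begin
      B.Ordering.value o
        ≡⟨ product (fromℕ n) (s (fromℕ n)) ⟩
      distances G (toℕ (fromℕ n)) (ι (s (fromℕ n)))
        ≡⟨ extend-last (ι ∘ s) ⟩
      distances G n (G n)
        ≡⟨ greedy⇒factorial (extend-greedy (ι ∘ s) minimal) ⟩
      [ + factorial ]
        ∎
      where
      open ≡-Reasoning

      s : Vector (∃[ s ] s ∈ S) (suc n)
      s i = B.Ordering.s o i , B.Ordering.s∈ o i

      G : ℕ → ∂̃
      G = extend (ι ∘ s)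

      product : ∀ i t → B.Ordering.valProduct o i (proj₁ t) ≡ distances G (toℕ i) (ι t)
      product i t = trans (valProduct-sum (λ (j : Fin′ i) → s (inject j)) t)
                          (before-sum (ι ∘ s) i (ι t))

      minimal : ∀ i ρ → distances G (toℕ i) (ι (s i)) ≤∞ distances G (toℕ i) ρ
      -- The ordering competes only with elements of `S`; density extends this to all boundary
      -- paths.
      minimal i = dense-lowerBound (applyDownFrom G (toℕ i)) λ t →
        subst₂ _≤∞_ (product i (s i)) (product i t) (B.Ordering.minimal o i (proj₂ t))

    treeOrdering : Ordering n
    treeOrdering = record
      { path     = F ∘ toℕ
      -- A repeated path would contribute `∞` to an increment that is finite.
      ; distinct = λ i j ρ≋τ → F-finite (Fin.toℕ≤pred[n] i)
          (trans (sym (toℕ-before-sum F i (F (toℕ i))))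
                 (summand-∞ (λ (j : Fin′ i) → d (F (toℕ i)) (F (toℕ (inject j)))) j
                   (≋⇒d≡∞ {F (toℕ i)} {F (toℕ (inject j))} ρ≋τ)))
      ; total    = λ i → proj₁ (total i)
      ; isTotal  = λ i → sum⇒PairingSum {ρ = F (toℕ i)}
          (trans (toℕ-before-sum F i (F (toℕ i))) (proj₂ (total i)))
      ; minimal  = λ i τ _ m τ-sum → ℤ.drop‿+≤+ ([≤]-injective
          (subst₂ _≤∞_ (proj₂ (total i))
            (trans (sym (toℕ-before-sum F i τ)) (PairingSum⇒sum τ-sum))
            (F-greedy (Fin.toℕ<n i) τ)))
      }
      where
      total : ∀ (i : Fin (suc n)) → ∃[ m ] distances F (toℕ i) (F (toℕ i)) ≡ [ + m ]
      total i = F-total (Fin.toℕ≤pred[n] i)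

    tree-value : ∀ (o : Ordering n) → Ordering.value o ≡ factorial
    tree-value o = ℤ.+-injective ([]-injective (begin
      [ + Ordering.value o ]
        ≡⟨ total≡ (fromℕ n) ⟨
      distances G (toℕ (fromℕ n)) (path (fromℕ n))
        ≡⟨ extend-last path ⟩
      distances G n (G n)
        ≡⟨ greedy⇒factorial (extend-greedy path G-minimal) ⟩
      [ + factorial ]
        ∎))
      where
      open ≡-Reasoning
      open Ordering o

      G : ℕ → ∂̃
      G = extend path

      total≡ : ∀ i → distances G (toℕ i) (path i) ≡ [ + total i ]
      total≡ i = trans (sym (before-sum path i (path i))) (PairingSum⇒sum (isTotal i))

      G-minimal : ∀ i ρ → distances G (toℕ i) (path i) ≤∞ distances G (toℕ i) ρ
      -- The ordering competes only with new paths having a finite pairing sum. An infinite sum is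
      -- no better than the chosen one, and a finite sum shows that `ρ` is none of the earlier
      -- paths.
      G-minimal i ρ = ≤∞-finite (pairSum-nonNegative ρ (applyDownFrom G (toℕ i))) λ m eq →
        subst₂ _≤∞_ (sym (total≡ i)) (sym eq) [≤ +≤+ (minimal i ρ
          (λ j ρ≋ → case trans (sym (trans sum≡ eq))
             (summand-∞ (λ (j : Fin′ i) → d ρ (path (inject j))) j
               (≋⇒d≡∞ {ρ} {path (inject j)} ρ≋)) of λ ())
          m (sum⇒PairingSum {ρ = ρ} (trans sum≡ eq))) ]
        where
        sum≡ : ∞Sum.sum (λ (j : Fin′ i) → d ρ (path (inject j))) ≡ distances G (toℕ i) ρ
        sum≡ = before-sum path i ρ

proposition1p2 : (∀ {ℓ} → ExcludedMiddle ℓ) →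
    ∀ {c ℓ₁ ℓ₂ p : Level} (K : NonArchimedeanLocalField c ℓ₁ ℓ₂) →
    let open NonArchimedeanLocalField K in
    (S : Pred Carrier p) → _Respects_ S _≈_ →
    (S⊆R : S ⊆ R) (nonEmpty : ∃[ s ] s ∈ S) →
    (n : ℕ) → (∀ N → HasCardinality (subsetSetoid S) N → n < N) →
    ∃[ m ] (BhargavaFactorial.IsFactorial discretelyValuedField S n [ + m ] ×
    TreeFactorial.IsFactorial (adelicTree discretelyValuedField S S⊆R nonEmpty) n m)
proposition1p2 em K S _ S⊆R nonEmpty n enough =
  factorial enough ,
  ((bhargavaOrdering enough , bhargava-value enough (bhargavaOrdering enough)) ,
   bhargava-value enough) ,
  ((treeOrdering enough , tree-value enough (treeOrdering enough)) ,
   tree-value enough)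
  where
  open AdelicTree em (NonArchimedeanLocalField.discretelyValuedField K) S S⊆R nonEmpty
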